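{- Let $1\le k<n$ be integers. Define integers $t_k,t_{k-1},\ldots,t_1$ one by one, from $l=k$ down to $l=1$, by letting $t_l$ be the smallest integer $x$ with $1\le x\le n-l$ satisfying $$d_l(x)\leq \frac{1}{l}\sum_{i=l}^{k-1}\left(\prod_{j=l+1}^i t_j\right)d_i(t_{i+1})+\frac{1}{l}\left(\prod_{j=l+1}^k t_j\right)\delta_{k,n}$$ (the empty sum is $0$ and the empty product is $1$), where $$\delta_{k,n}:=\begin{cases}-\frac{1}{n}\sum_{j=1}^{n-1}\frac{1}{j},& k=1,\\[4pt] \frac{(n-k)!}{n!},& k>1,\end{cases}$$ and for $0\le l\le k$ the map $d_l\colon\{1,\ldots,n-l\}\to\mathbb{R}$ is $$d_l(x):=\begin{cases}-1+\frac{kx}{n}+\frac{\binom{n-x-1}{k}}{\binom{n}{k}}+\frac{x}{\binom{n}{k}}\sum_{j=1}^{x}\frac{\binom{n-j-1}{k-1}}{j},& l=0,\\[6pt] -\frac{k}{n}-\frac{1}{\binom{n}{k}}\sum_{j=1}^{x}\frac{\binom{n-j-1}{k-1}}{j},& l=1,\\[6pt] \frac{k\cdot x!\,(n-l-x)!}{l(l-1)\,n!}\sum_{j=0}^{l-2}\binom{k-1}{j}\binom{n-k}{x+l-j-1},& 1<l\le k.\end{cases}$$ Put $s_l:=t_l+l-1$ for every $1\le l\le k$. Then $(s_1,\ldots,s_k)$ is an optimal sequence.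
   Context: Binomial convention: for integers $m,j$, $\binom{m}{j}=\frac{m(m-1)\cdots(m-j+1)}{j!}$ if $j\ge 0$ and $\binom{m}{j}=0$ if $j<0$. Setting (generalized secretary problem). There are $n$ candidates with distinct ranks $1,\ldots,n$ (rank $1$ is the best) arriving in uniformly random order: all $n!$ orderings are equally likely. An ordering is a permutation $\pi$ of $\{1,\ldots,n\}$, where $\pi(i)$ is the rank of the $i$-th candidate. At time $i$ only the relative ranks of the first $i$ candidates are known. Success means selecting a candidate of rank in $\{1,\ldots,k\}$. Policy associated with a sequence. Let $(s_1,\ldots,s_k)$ be a non-decreasing sequence of integers with $l\le s_l<n$ for every $1\le l\le k$, and put $s_{k+1}:=n-1$. The policy with this sequence selects the $i_0$-th candidate, where $i_0\in\{1,\ldots,n\}$ is the smallest integer for which there is $l\in\{1,\ldots,k\}$ with (i) $s_l<i_0\le s_{l+1}$, and (ii) the $i_0$-th candidate is one of the $l$ best among the first $i_0$ candidates. If no such $i_0$ exists, it selects the $n$-th candidate. An optimal sequence is a non-decreasing sequence of integers $(s_1,\ldots,s_k)$ with $l\le s_l<n$ for every $1\le l\le k$ which maximizes, among all such sequences, the probability of success of the associated policy. -}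

module Defs where

open import Algebra.Properties.CommutativeMonoid.Sum using (sum)
open import Data.Bool.Base using (if_then_else_)
open import Data.Fin as Fin using (Fin; toℕ; fromℕ)
open import Data.Fin.Permutation as Permutation
  using (Permutation′; _⟨$⟩ʳ_; _≈_; insert; remove; insert-remove)
open import Data.Fin.Properties using (any?; _≟_)
open import Data.Integer.Base as ℤ using (ℤ; +_; -[1+_]; 1ℤ)
import Data.Integer.Properties as ℤ
open import Data.List.Base
  using (List; []; _∷_; [_]; map; length; filter; find; allFin; cartesianProductWith)
open import Data.List.Membership.Propositional.Properties using (∈-allFin)
open import Data.List.Properties using (length-++; length-map; length-tabulate)
open import Data.List.Relation.Unary.Any using (Any; here)
open import Data.List.Relation.Unary.Any.Properties using (cartesianProductWith⁺)
open import Data.Maybe.Base using (fromMaybe)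
open import Data.Nat.Base
  using (ℕ; zero; suc; _+_; _*_; _∸_; _≤_; _<_; _≤ᵇ_; s≤s; z≤n; _!; NonZero; >-nonZero)
open import Data.Nat.Combinatorics.Base using (_P′_)
open import Data.Nat.Properties
  using (_≤?_; _<?_; _!≢0; m*n≢0; <⇒≤; m<n⇒0<n∸m; ≤-trans; *-1-commutativeMonoid)
open import Data.Product.Base using (∃-syntax; _×_)
open import Data.Rational.Base as ℚ using (ℚ; 1ℚ; 0ℚ; _/_; _÷_)
import Data.Rational.Properties as ℚ
open import Relation.Binary.PropositionalEquality
  using (_≡_; refl; sym; trans; cong; cong₂; module ≡-Reasoning)
open import Relation.Nullary.Decidable using (yes; no; _×-dec_)
open import Relation.Unary using (Pred; Decidable)
open import Level using (0ℓ)

open import Algebra.Properties.CommutativeMonoid.Sum ℚ.+-0-commutativeMonoid using (sum-syntax)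

∏-syntax : ∀ n → (Fin n → ℕ) → ℕ
∏-syntax n = sum *-1-commutativeMonoid

infixl 10 ∏-syntax
syntax ∏-syntax n (λ i → x) = ∏[ i < n ] x

-- m (m − 1) ⋯ (m − j + 1)
fallingFactorial : ℤ → ℕ → ℤ
fallingFactorial m zero    = 1ℤ
fallingFactorial m (suc j) = (m ℤ.- + j) ℤ.* fallingFactorial m j

binomial : ℤ → ℤ → ℚ
binomial m (+ j)    = _/_ (fallingFactorial m j) (j !) {{j !≢0}}
binomial m -[1+ _ ] = 0ℚ

fallingFactorial≡P′ : ∀ {m} j → j ≤ m → fallingFactorial (+ m) j ≡ + (m P′ j)
fallingFactorial≡P′ zero    _   = refl
fallingFactorial≡P′ {m} (suc j) j<m = begin
  (+ m ℤ.- + j) ℤ.* fallingFactorial (+ m) j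
    ≡⟨ cong₂ ℤ._*_ (trans (ℤ.m-n≡m⊖n m j) (ℤ.⊖-≥ (<⇒≤ j<m))) (fallingFactorial≡P′ j (<⇒≤ j<m)) ⟩
  + (m ∸ j) ℤ.* + (m P′ j)
    ≡⟨ sym (ℤ.pos-* (m ∸ j) (m P′ j)) ⟩
  + (m P′ suc j) ∎
  where open ≡-Reasoning

P′-nonZero : ∀ {m} j → j ≤ m → NonZero (m P′ j)
P′-nonZero     zero    _   = _
P′-nonZero {m} (suc j) j<m =
  m*n≢0 (m ∸ j) (m P′ j) {{>-nonZero (m<n⇒0<n∸m j<m)}} {{P′-nonZero j (<⇒≤ j<m)}}

binomial-nonZero : ∀ {m j} → j ≤ m → ℚ.NonZero (binomial (+ m) (+ j))
binomial-nonZero {m} {j} j≤m rewrite fallingFactorial≡P′ j j≤m =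
  ℚ.pos⇒nonZero (ℚ.normalize (m P′ j) (j !) {{j !≢0}})
    {{ℚ.normalize-pos (m P′ j) (j !) {{j !≢0}} {{P′-nonZero j j≤m}}}}

-- All orderings of n candidates: π ⟨$⟩ʳ i is the rank of candidate i, where
-- both candidates and ranks are counted from 0.
orderings : ∀ n → List (Permutation′ n)
orderings zero    = [ Permutation.id ]
orderings (suc n) = cartesianProductWith (insert (fromℕ n)) (allFin (suc n)) (orderings n)

private
  length-cartesianProductWith : ∀ {A B C : Set} (f : A → B → C) xs ys →
    length (cartesianProductWith f xs ys) ≡ length xs * length ys
  length-cartesianProductWith f []       ys = refl
  length-cartesianProductWith f (x ∷ xs) ys =
    trans (length-++ (map (f x) ys))
          (cong₂ _+_ (length-map (f x) ys) (length-cartesianProductWith f xs ys))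

  insert-cong : ∀ {n} i {j j′} {π ρ : Permutation′ n} → j ≡ j′ → π ≈ ρ →
                insert i j π ≈ insert i j′ ρ
  insert-cong i {j} refl π≈ρ k with i ≟ k
  ... | yes _ = refl
  ... | no  _ = cong (Fin.punchIn j) (π≈ρ _)

-- Together, the next two facts say that every ordering is listed exactly once.
length-orderings : ∀ n → length (orderings n) ≡ n !
length-orderings zero    = refl
length-orderings (suc n) =
  trans (length-cartesianProductWith (insert (fromℕ n)) (allFin (suc n)) (orderings n))
        (cong₂ _*_ (length-tabulate {n = suc n} (λ i → i)) (length-orderings n))

orderings-complete : ∀ {n} (π : Permutation′ n) → Any (π ≈_) (orderings n)
orderings-complete {zero}  π = here λ ()
orderings-complete {suc n} π = cartesianProductWith⁺ (insert (fromℕ n))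
  (λ {j} {ρ} πᵢ≡j π′≈ρ k → trans (sym (insert-remove (fromℕ n) π k)) (insert-cong (fromℕ n) πᵢ≡j π′≈ρ k))
  (∈-allFin (π ⟨$⟩ʳ fromℕ n))
  (orderings-complete (remove (fromℕ n) π))

-- Probability of an event under the uniform distribution on orderings.
Pr : ∀ {n} {E : Pred (Permutation′ n) 0ℓ} → Decidable E → ℚ
Pr {n} E? = _/_ (+ length (filter E? (orderings n))) (n !) {{n !≢0}}

-- The rank of candidate i among the candidates that have arrived up to and
-- including i; the best of them has relative rank 1.
relativeRank : ∀ {n} → Permutation′ n → Fin n → ℕ
relativeRank {n} π i =
  length (filter (λ j → (j Fin.≤? i) ×-dec ((π ⟨$⟩ʳ j) Fin.≤? (π ⟨$⟩ʳ i))) (allFin n))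

last : ∀ n .{{_ : NonZero n}} → Fin n
last (suc n) = fromℕ n

IsLeast : Pred ℕ 0ℓ → ℕ → Set
IsLeast P x = P x × (∀ y → P y → x ≤ y)

δ : (k n : ℕ) .{{_ : NonZero n}} → ℚ
δ 1 n = ℚ.- ((1ℤ / n) ℚ.* ∑[ j < n ∸ 1 ] (1ℤ / suc (toℕ j)))
δ k n = _/_ (+ ((n ∸ k) !)) (n !) {{n !≢0}}

-- A sequence (a₁, …, aₖ) is represented by a function ℕ → ℕ of which only the
-- values at 1, …, k matter.
module Secretary (n k : ℕ) (k<n : k < n) where

  private instance
    n-nonZero : NonZero n
    n-nonZero = >-nonZero (≤-trans (s≤s z≤n) k<n)

    binomial-n-k-nonZero : ℚ.NonZero (binomial (+ n) (+ k))
    binomial-n-k-nonZero = binomial-nonZero (<⇒≤ k<n)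

  -- Sequence extended by s₍ₖ₊₁₎ = n − 1.
  extend : (ℕ → ℕ) → ℕ → ℕ
  extend s l = if l ≤ᵇ k then s l else n ∸ 1

  IsAdmissible : (ℕ → ℕ) → Set
  IsAdmissible s = (∀ l → 1 ≤ l → l ≤ k → l ≤ s l × s l < n)
                 × (∀ l m → 1 ≤ l → l ≤ m → m ≤ k → s l ≤ s m)

  -- Candidate i is number suc (toℕ i) in order of arrival, and p stands for
  -- the index l = suc (toℕ p) ∈ {1, …, k}.
  Acceptable : (ℕ → ℕ) → Permutation′ n → Fin n → Set
  Acceptable s π i = ∃[ p ]
    let l = suc (toℕ {k} p) in
    extend s l < suc (toℕ i) × suc (toℕ i) ≤ extend s (suc l) × relativeRank π i ≤ l

  acceptable? : ∀ s π → Decidable (Acceptable s π)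
  acceptable? s π i = any? λ p →
    (_ <? _) ×-dec ((_ ≤? _) ×-dec (_ ≤? _))

  select : (ℕ → ℕ) → Permutation′ n → Fin n
  select s π = fromMaybe (last n) (find (acceptable? s π) (allFin n))

  Success : (ℕ → ℕ) → Permutation′ n → Set
  Success s π = suc (toℕ (π ⟨$⟩ʳ select s π)) ≤ k

  success? : ∀ s → Decidable (Success s)
  success? s π = suc (toℕ (π ⟨$⟩ʳ select s π)) ≤? k

  IsOptimal : (ℕ → ℕ) → Set
  IsOptimal s = IsAdmissible s
              × (∀ s′ → IsAdmissible s′ → Pr (success? s′) ℚ.≤ Pr (success? s))

  -- The sum ∑ⱼ₌₁ˣ is indexed by i = j − 1.
  innerSum : ℕ → ℚ
  innerSum x = ∑[ i < x ] (let j = suc (toℕ i) in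
    binomial (+ n ℤ.- + j ℤ.- 1ℤ) (+ k ℤ.- 1ℤ) ℚ.* (1ℤ / j))

  -- Only meaningful for l ≤ k and 1 ≤ x ≤ n − l; it is not evaluated elsewhere
  -- by IsThresholds below.
  d : ℕ → ℕ → ℚ
  d 0 x = ℚ.- 1ℚ ℚ.+ (+ (k * x) / n)
          ℚ.+ binomial (+ n ℤ.- + x ℤ.- 1ℤ) (+ k) ÷ binomial (+ n) (+ k)
          ℚ.+ ((+ x / 1) ÷ binomial (+ n) (+ k)) ℚ.* innerSum x
  d 1 x = ℚ.- (+ k / n) ℚ.- (1ℚ ÷ binomial (+ n) (+ k)) ℚ.* innerSum x
  d l@(suc (suc l-2)) x =
    _/_ (+ (k * x ! * (n ∸ l ∸ x) !)) (l * (l ∸ 1) * n !)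
        {{m*n≢0 (l * (l ∸ 1)) (n !) {{_}} {{n !≢0}}}}
    ℚ.* ∑[ j < suc l-2 ] (binomial (+ k ℤ.- 1ℤ) (+ toℕ j)
          ℚ.* binomial (+ n ℤ.- + k) (+ x ℤ.+ + l ℤ.- + toℕ j ℤ.- 1ℤ))

  -- ∏ⱼ₌ₗ₊₁ⁱ tⱼ, with j = l + 1 + r
  product : (ℕ → ℕ) → ℕ → ℕ → ℚ
  product t l i = + (∏[ r < i ∸ l ] t (l + 1 + toℕ r)) / 1

  -- The outer sum ∑ᵢ₌ₗᵏ⁻¹ is indexed by r = i − l.
  bound : (ℕ → ℕ) → (l : ℕ) .{{_ : NonZero l}} → ℚ
  bound t l =
    (1ℤ / l) ℚ.* ∑[ r < k ∸ l ] (let i = l + toℕ r in product t l i ℚ.* d i (t (i + 1)))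
    ℚ.+ (1ℤ / l) ℚ.* product t l k ℚ.* δ k n

  -- As bound t l depends only on tₗ₊₁, …, tₖ, this is the recursive definition
  -- of tₖ, …, t₁.
  IsThresholds : (ℕ → ℕ) → Set
  IsThresholds t = ∀ l .{{_ : NonZero l}} → l ≤ k →
    IsLeast (λ x → 1 ≤ x × x ≤ n ∸ l × d l x ℚ.≤ bound t l) (t l)

-- Let q m j be the probability that exactly j of the k best candidates are among the first m. The
-- candidate of relative rank r among the first m is one of the k best exactly when at least r of
-- these are among the first m. Hence the probability of success after passing over the first m
-- candidates satisfies a backward recurrence with coefficients in q, whose solutions, as long as
-- the l best so far are acceptable, form a family A l m − w m (m − 1) ⋯ (m − l + 1) with parameter w.
-- Matching the solutions at the times s l determines w = W l, where W k = δ and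
-- W l = d l (tₗ₊₁) + tₗ₊₁ W (l + 1); the probability of success is − W 0, and bound t l is W l / l.
--
-- Since d l x − d l (x + 1) = (l + 1) d (l + 1) x and d (l + 1) is nonincreasing, the least x with
-- d (l + 1) x ≤ W (l + 1) / (l + 1) minimises d l x + x W (l + 1). By induction from k downwards the
-- thresholds minimise W 0 over all t with 1 ≤ tₗ ≤ n − l, whether or not s is nondecreasing. Finally
-- (x + l) d l (x + 1) ≤ (x + 1) d l x shows that tₗ₊₁ + 1 satisfies the inequality for l; so tₗ exists
-- and tₗ ≤ tₗ₊₁ + 1, which is s l ≤ s (l + 1).

module Submission where

open import Defs

-- Let R be the number of the k best among the first m candidates. While the l best so far are
-- acceptable, the probability U of success satisfies (m + 1) U(m) = S + (m + 1 - l) U(m + 1), where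
-- S is the expectation of min(R, l) taken at time m + 1. For l ≥ 2 a particular solution is the
-- expectation of min(1, R / (l - 1)), and this is `A l`. For l = 1 the denominator vanishes; this
-- is why d 0 and d 1 contain a sum of harmonic type and have to be treated separately throughout.
--
-- At a given time the particular solutions for l and l + 1 differ by a multiple of [m]ₗ, and the
-- coefficient is d l: this is the origin of the functions in the statement.
--
-- Of q, this analysis uses only its one-step recurrence, its nonnegativity and its values at time
-- n. The binomial formulas matter only for checking these facts and for recognising the d and δ of
-- the statement.

module Proof where

  open import Algebra.Bundles using (CommutativeRing)
  open import Data.Bool.Base using (Bool; true; false; if_then_else_)
  open import Data.Fin.Base as Fin using (Fin; zero; suc; toℕ; fromℕ; fromℕ<; inject₁; punchIn)
  open import Data.Fin.Permutation using (Permutation′; _⟨$⟩ʳ_; insert; insert-punchIn)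
  open import Data.Fin.Properties as Fin
    using (any?; toℕ<n; toℕ-fromℕ; toℕ-fromℕ<; toℕ-inject₁; ≤fromℕ; punchIn-mono-≤; punchIn-cancel-≤)
  open import Data.Integer.Base as ℤ using (ℤ; +_; 0ℤ; 1ℤ)
  import Data.Integer.Properties as ℤ
  import Data.Integer.Tactic.RingSolver as ℤSolver
  open import Data.List.Base
    using (List; []; _∷_; map; _++_; length; filter; find; tabulate; allFin; cartesianProductWith)
  open import Data.Maybe.Base as Maybe using (Maybe; just; nothing; maybe; fromMaybe; _<∣>_)
  open import Data.Nat.Base as ℕ using (ℕ; zero; suc; NonZero; s≤s; z≤n; _!; _∸_)
  open import Data.Nat.Combinatorics.Base using (_P′_)
  import Data.Nat.Properties as ℕ
  open import Data.Product.Base using (∃-syntax; _×_; _,_; proj₁; proj₂)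
  open import Data.Rational.Base as ℚ hiding (NonZero; ∣_∣)
  open import Data.Rational.Properties as ℚ hiding (_≟_; _≤?_)
  import Data.Rational.Unnormalised.Base as ℚᵘ
  import Data.Rational.Unnormalised.Properties as ℚᵘ
  open import Data.Sum.Base using (_⊎_; inj₁; inj₂; [_,_]′)
  open import Function.Base using (_∘_)
  open import Function.Bundles using (mk⇔)
  open import Level using (0ℓ)
  open import Relation.Binary.PropositionalEquality hiding (J)
  open import Relation.Nullary.Decidable
    using (Dec; yes; no; does; does-⇔; dec-true; dec-false; dec⇒maybe; _×-dec_)
  open import Relation.Nullary.Negation using (¬_; contradiction)
  open import Relation.Unary using (Pred; Decidable)
  open import Tactic.RingSolver using (solve; solve-∀)
  open import Tactic.RingSolver.Core.AlmostCommutativeRing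
    using (AlmostCommutativeRing; fromCommutativeRing)

  import Algebra.Properties.CommutativeMonoid.Sum ℕ.*-1-commutativeMonoid as ∏
  open import Algebra.Properties.CommutativeMonoid.Sum ℕ.+-0-commutativeMonoid using ()
    renaming (sum to sumℕ; sum-cong-≗ to sumℕ-cong; sum-init-last to sumℕ-init-last;
              sum-permute to sumℕ-permute; sum-replicate-zero to sumℕ-zero)
  open import Algebra.Properties.Semiring.Sum (CommutativeRing.semiring ℚ.+-*-commutativeRing)
    using (sum-syntax; sum-cong-≗; *-distribˡ-sum; ∑-distrib-+; sum-replicate-zero)

  -- Rational arithmetic: embeddings, cancellation, linear combinations of equations

  ℚ-ring : AlmostCommutativeRing _ _
  ℚ-ring = fromCommutativeRing +-*-commutativeRing (λ x → dec⇒maybe (0ℚ ℚ.≟ x))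

  ℤ→ℚ : ℤ → ℚ
  ℤ→ℚ i = i / 1

  toℚᵘ-/ : ∀ i m .{{_ : NonZero m}} → toℚᵘ (i / m) ℚᵘ.≃ (i ℚᵘ./ m)
  toℚᵘ-/ i (suc m) = ℚ.toℚᵘ-fromℚᵘ (ℚᵘ.mkℚᵘ i m)

  ℤ→ℚ-+ : ∀ i j → ℤ→ℚ (i ℤ.+ j) ≡ ℤ→ℚ i + ℤ→ℚ j
  ℤ→ℚ-+ i j = toℚᵘ-injective (begin
    toℚᵘ (ℤ→ℚ (i ℤ.+ j))                 ≈⟨ toℚᵘ-/ (i ℤ.+ j) 1 ⟩
    (i ℤ.+ j) ℚᵘ./ 1                     ≈⟨ ℚᵘ.*≡* (cong (ℤ._* 1ℤ) (sym (cong₂ ℤ._+_ (ℤ.*-identityʳ i) (ℤ.*-identityʳ j)))) ⟩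
    (i ℚᵘ./ 1) ℚᵘ.+ (j ℚᵘ./ 1)           ≈⟨ ℚᵘ.+-cong (toℚᵘ-/ i 1) (toℚᵘ-/ j 1) ⟨
    toℚᵘ (ℤ→ℚ i) ℚᵘ.+ toℚᵘ (ℤ→ℚ j)       ≈⟨ toℚᵘ-homo-+ (ℤ→ℚ i) (ℤ→ℚ j) ⟨
    toℚᵘ (ℤ→ℚ i + ℤ→ℚ j)                 ∎)
    where open ℚᵘ.≃-Reasoning

  ℤ→ℚ-* : ∀ i j → ℤ→ℚ (i ℤ.* j) ≡ ℤ→ℚ i * ℤ→ℚ j
  ℤ→ℚ-* i j = toℚᵘ-injective (begin
    toℚᵘ (ℤ→ℚ (i ℤ.* j))                 ≈⟨ toℚᵘ-/ (i ℤ.* j) 1 ⟩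
    (i ℤ.* j) ℚᵘ./ 1                     ≈⟨ ℚᵘ.*≡* refl ⟩
    (i ℚᵘ./ 1) ℚᵘ.* (j ℚᵘ./ 1)           ≈⟨ ℚᵘ.*-cong (toℚᵘ-/ i 1) (toℚᵘ-/ j 1) ⟨
    toℚᵘ (ℤ→ℚ i) ℚᵘ.* toℚᵘ (ℤ→ℚ j)       ≈⟨ toℚᵘ-homo-* (ℤ→ℚ i) (ℤ→ℚ j) ⟨
    toℚᵘ (ℤ→ℚ i * ℤ→ℚ j)                 ∎)
    where open ℚᵘ.≃-Reasoning

  ℤ→ℚ-neg : ∀ i → ℤ→ℚ (ℤ.- i) ≡ - ℤ→ℚ i
  ℤ→ℚ-neg i = toℚᵘ-injective (begin
    toℚᵘ (ℤ→ℚ (ℤ.- i))   ≈⟨ toℚᵘ-/ (ℤ.- i) 1 ⟩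
    (ℤ.- i) ℚᵘ./ 1       ≈⟨ ℚᵘ.*≡* refl ⟩
    ℚᵘ.- (i ℚᵘ./ 1)      ≈⟨ ℚᵘ.-‿cong (toℚᵘ-/ i 1) ⟨
    ℚᵘ.- toℚᵘ (ℤ→ℚ i)    ≈⟨ toℚᵘ-homo‿- (ℤ→ℚ i) ⟨
    toℚᵘ (- ℤ→ℚ i)       ∎)
    where open ℚᵘ.≃-Reasoning

  -- Defined by recursion, so that `ι (suc m)` unfolds to `1ℚ + ι m`: polynomial identities stated
  -- with `1ℚ + a` then apply to successors without rewriting.
  ι : ℕ → ℚ
  ι zero    = 0ℚ
  ι (suc m) = 1ℚ + ι m

  ι≡/1 : ∀ m → ι m ≡ + m / 1
  ι≡/1 zero    = refl
  ι≡/1 (suc m) = trans (cong (λ p → 1ℚ + p) (ι≡/1 m)) (sym (ℤ→ℚ-+ 1ℤ (+ m)))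

  ι-+ : ∀ m n → ι (m ℕ.+ n) ≡ ι m + ι n
  ι-+ zero    n = sym (+-identityˡ (ι n))
  ι-+ (suc m) n = trans (cong (λ p → 1ℚ + p) (ι-+ m n)) (sym (+-assoc 1ℚ (ι m) (ι n)))

  ι-* : ∀ m n → ι (m ℕ.* n) ≡ ι m * ι n
  ι-* m n = begin
    ι (m ℕ.* n)              ≡⟨ ι≡/1 (m ℕ.* n) ⟩
    ℤ→ℚ (+ (m ℕ.* n))        ≡⟨ cong ℤ→ℚ (ℤ.pos-* m n) ⟩
    ℤ→ℚ (+ m ℤ.* + n)        ≡⟨ ℤ→ℚ-* (+ m) (+ n) ⟩
    ℤ→ℚ (+ m) * ℤ→ℚ (+ n)    ≡⟨ cong₂ _*_ (ι≡/1 m) (ι≡/1 n) ⟨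
    ι m * ι n                ∎
    where open ≡-Reasoning

  ι-nonNeg : ∀ m → NonNegative (ι m)
  ι-nonNeg m rewrite ι≡/1 m = normalize-nonNeg m 1

  ι-pos : ∀ m .{{_ : NonZero m}} → Positive (ι m)
  ι-pos m rewrite ι≡/1 m = normalize-pos m 1

  /-*-cancel : ∀ i m .{{_ : NonZero m}} → (i / m) * ι m ≡ ℤ→ℚ i
  /-*-cancel i m@(suc _) = toℚᵘ-injective (begin
    toℚᵘ ((i / m) * ι m)                 ≡⟨ cong (λ p → toℚᵘ ((i / m) * p)) (ι≡/1 m) ⟩
    toℚᵘ ((i / m) * (+ m / 1))           ≈⟨ toℚᵘ-homo-* (i / m) (+ m / 1) ⟩
    toℚᵘ (i / m) ℚᵘ.* toℚᵘ (+ m / 1)     ≈⟨ ℚᵘ.*-cong (toℚᵘ-/ i m) (toℚᵘ-/ (+ m) 1) ⟩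
    (i ℚᵘ./ m) ℚᵘ.* (+ m ℚᵘ./ 1)         ≈⟨ ℚᵘ.*≡* (trans (ℤ.*-identityʳ _) (cong (i ℤ.*_) (cong (λ x → + x) (sym (ℕ.*-identityʳ m))))) ⟩
    i ℚᵘ./ 1                             ≈⟨ toℚᵘ-/ i 1 ⟨
    toℚᵘ (ℤ→ℚ i)                         ∎)
    where open ℚᵘ.≃-Reasoning

  -- The shift by one makes the reciprocal total.
  inv : ℕ → ℚ
  inv m = 1ℤ / suc m

  inv-inverse : ∀ m → inv m * ι (suc m) ≡ 1ℚ
  inv-inverse m = /-*-cancel 1ℤ (suc m)

  inv-nonNeg : ∀ m → NonNegative (inv m)
  inv-nonNeg m = normalize-nonNeg 1 (suc m)

  *-cancelʳ : ∀ c .{{_ : ℚ.NonZero c}} {x y} → x * c ≡ y * c → x ≡ y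
  *-cancelʳ c {x} {y} eq = begin
    x                ≡⟨ *-identityʳ x ⟨
    x * 1ℚ           ≡⟨ cong (x *_) (*-inverseʳ c) ⟨
    x * (c * 1/ c)   ≡⟨ *-assoc x c (1/ c) ⟨
    x * c * 1/ c     ≡⟨ cong (_* 1/ c) eq ⟩
    y * c * 1/ c     ≡⟨ *-assoc y c (1/ c) ⟩
    y * (c * 1/ c)   ≡⟨ cong (y *_) (*-inverseʳ c) ⟩
    y * 1ℚ           ≡⟨ *-identityʳ y ⟩
    y                ∎
    where open ≡-Reasoning

  ι-nonZero : ∀ m .{{_ : NonZero m}} → ℚ.NonZero (ι m)
  ι-nonZero m = pos⇒nonZero (ι m) {{ι-pos m}}

  *-cancelʳ-ι : ∀ m .{{_ : NonZero m}} {x y} → x * ι m ≡ y * ι m → x ≡ y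
  *-cancelʳ-ι m = *-cancelʳ (ι m) {{ι-nonZero m}}

  -- x ≡ y as a linear combination of given equations: the last argument is left to the ring solver.
  private
    x-x≡0 : ∀ {a b : ℚ} → a ≡ b → a - b ≡ 0ℚ
    x-x≡0 {a} refl = +-inverseʳ a

  x-y≡0⇒x≡y : ∀ {x y} → x - y ≡ 0ℚ → x ≡ y
  x-y≡0⇒x≡y {x} {y} eq = begin
    x              ≡⟨ lemma x y ⟩
    (x - y) + y    ≡⟨ cong (_+ y) eq ⟩
    0ℚ + y         ≡⟨ +-identityˡ y ⟩
    y              ∎
    where
    open ≡-Reasoning
    lemma : ∀ x y → x ≡ (x - y) + y
    lemma = solve-∀ ℚ-ring

  lincomb₁ : ∀ {x y a b} c → a ≡ b → x - y ≡ c * (a - b) → x ≡ y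
  lincomb₁ {a = a} c eq h = x-y≡0⇒x≡y (trans h (trans (cong (c *_) (x-x≡0 eq)) (*-zeroʳ c)))

  lincomb₂ : ∀ {x y a b a′ b′} c c′ → a ≡ b → a′ ≡ b′ →
             x - y ≡ c * (a - b) + c′ * (a′ - b′) → x ≡ y
  lincomb₂ {a = a} {b} {a′} c c′ eq refl h = lincomb₁ c eq (trans h (lemma (c * (a - b)) c′ a′))
    where
    lemma : ∀ e c′ a′ → e + c′ * (a′ - a′) ≡ e
    lemma = solve-∀ ℚ-ring

  lincomb₃ : ∀ {x y a b a′ b′ a″ b″} c c′ c″ → a ≡ b → a′ ≡ b′ → a″ ≡ b″ →
             x - y ≡ c * (a - b) + c′ * (a′ - b′) + c″ * (a″ - b″) → x ≡ y
  lincomb₃ {a = a} {b} {a′} {b′} {a″} c c′ c″ eq eq′ refl h =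
    lincomb₂ c c′ eq eq′ (trans h (lemma (c * (a - b) + c′ * (a′ - b′)) c″ a″))
    where
    lemma : ∀ e c″ a″ → e + c″ * (a″ - a″) ≡ e
    lemma = solve-∀ ℚ-ring

  0≤ι : ∀ m → 0ℚ ≤ ι m
  0≤ι m = nonNegative⁻¹ (ι m) {{ι-nonNeg m}}

  0≤inv : ∀ m → 0ℚ ≤ inv m
  0≤inv m = nonNegative⁻¹ (inv m) {{inv-nonNeg m}}

  0≤* : ∀ {x y} → 0ℚ ≤ x → 0ℚ ≤ y → 0ℚ ≤ x * y
  0≤* {x} {y} 0≤x 0≤y =
    nonNegative⁻¹ (x * y) {{nonNeg*nonNeg⇒nonNeg x {{nonNegative 0≤x}} y {{nonNegative 0≤y}}}}

  0≤+ : ∀ {x y} → 0ℚ ≤ x → 0ℚ ≤ y → 0ℚ ≤ x + y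
  0≤+ {x} {y} 0≤x 0≤y = subst (_≤ x + y) (+-identityˡ 0ℚ) (+-mono-≤ 0≤x 0≤y)

  0≤y-x⇒x≤y : ∀ {x y} → 0ℚ ≤ y - x → x ≤ y
  0≤y-x⇒x≤y {x} {y} h = subst₂ _≤_ (+-identityˡ x) (lemma x y) (+-monoˡ-≤ x h)
    where
    lemma : ∀ x y → (y - x) + x ≡ y
    lemma = solve-∀ ℚ-ring

  x≤y⇒0≤y-x : ∀ {x y} → x ≤ y → 0ℚ ≤ y - x
  x≤y⇒0≤y-x {x} {y} h = subst (_≤ y - x) (+-inverseʳ x) (+-monoˡ-≤ (- x) h)

  ≤-by : ∀ {x y e} → 0ℚ ≤ e → y - x ≡ e → x ≤ y
  ≤-by 0≤e eq = 0≤y-x⇒x≤y (subst (0ℚ ≤_) (sym eq) 0≤e)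

  lincomb₄ : ∀ {x y a b a′ b′ a″ b″ a‴ b‴} c c′ c″ c‴ → a ≡ b → a′ ≡ b′ → a″ ≡ b″ → a‴ ≡ b‴ →
             x - y ≡ c * (a - b) + c′ * (a′ - b′) + c″ * (a″ - b″) + c‴ * (a‴ - b‴) → x ≡ y
  lincomb₄ {a = a} {b} {a′} {b′} {a″} {b″} {a‴} c c′ c″ c‴ eq eq′ eq″ refl h =
    lincomb₃ c c′ c″ eq eq′ eq″ (trans h (lemma (c * (a - b) + c′ * (a′ - b′) + c″ * (a″ - b″)) c‴ a‴))
    where
    lemma : ∀ e c‴ a‴ → e + c‴ * (a‴ - a‴) ≡ e
    lemma = solve-∀ ℚ-ring

  ∑-snoc : ∀ r (f : ℕ → ℚ) → ∑[ j < suc r ] f (toℕ j) ≡ ∑[ j < r ] f (toℕ j) + f r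
  ∑-snoc zero    f = +-comm (f 0) 0ℚ
  ∑-snoc (suc r) f = trans (cong (λ p → f 0 + p) (∑-snoc r (λ j → f (suc j)))) (sym (+-assoc (f 0) _ _))

  -- (x + 1)(x + 2)⋯(x + l), a falling factorial of m = l + x. With x rather than m as the variable,
  -- no subtraction of naturals enters the recurrences.
  rise : ℕ → ℕ → ℚ
  rise x zero    = 1ℚ
  rise x (suc l) = rise x l * ι (suc (l ℕ.+ x))

  rise⁻¹ : ℕ → ℕ → ℚ
  rise⁻¹ x zero    = 1ℚ
  rise⁻¹ x (suc l) = rise⁻¹ x l * inv (l ℕ.+ x)

  rise-suc : ∀ x l → rise x (suc l) ≡ ι (suc x) * rise (suc x) l
  rise-suc x zero    = *-comm 1ℚ (ι (suc x))
  rise-suc x (suc l) = trans (cong₂ _*_ (rise-suc x l) (cong (λ y → ι (suc y)) (sym (ℕ.+-suc l x))))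
                             (*-assoc (ι (suc x)) (rise (suc x) l) (ι (suc (l ℕ.+ suc x))))

  rise-rise⁻¹ : ∀ x l → rise x l * rise⁻¹ x l ≡ 1ℚ
  rise-rise⁻¹ x zero    = refl
  rise-rise⁻¹ x (suc l) =
    alg (rise x l) (rise⁻¹ x l) (ι (suc (l ℕ.+ x))) (inv (l ℕ.+ x)) (rise-rise⁻¹ x l) (inv-inverse (l ℕ.+ x))
    where
    alg : ∀ r r⁻¹ a i → r * r⁻¹ ≡ 1ℚ → i * a ≡ 1ℚ → (r * a) * (r⁻¹ * i) ≡ 1ℚ
    alg r r⁻¹ a i h h′ = lincomb₂ (a * i) 1ℚ h h′ (solve (r ∷ r⁻¹ ∷ a ∷ i ∷ []) ℚ-ring)

  rise⁻¹-suc : ∀ x l → rise⁻¹ (suc x) l ≡ ι (suc x) * rise⁻¹ x (suc l)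
  rise⁻¹-suc x zero    = alg (inv x) (ι (suc x)) (inv-inverse x)
    where
    alg : ∀ i a → i * a ≡ 1ℚ → 1ℚ ≡ a * (1ℚ * i)
    alg i a h = lincomb₁ (- 1ℚ) h (solve (i ∷ a ∷ []) ℚ-ring)
  rise⁻¹-suc x (suc l) = trans (cong₂ _*_ (rise⁻¹-suc x l) (cong inv (ℕ.+-suc l x)))
                               (*-assoc (ι (suc x)) (rise⁻¹ x (suc l)) (inv (suc l ℕ.+ x)))

  rise⁻¹-shrink : ∀ x l → rise⁻¹ x l ≡ ι (suc (l ℕ.+ x)) * rise⁻¹ x (suc l)
  rise⁻¹-shrink x l = alg (rise⁻¹ x l) (ι (suc (l ℕ.+ x))) (inv (l ℕ.+ x)) (inv-inverse (l ℕ.+ x))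
    where
    alg : ∀ r a i → i * a ≡ 1ℚ → r ≡ a * (r * i)
    alg r a i h = lincomb₁ (- r) h (solve (r ∷ a ∷ i ∷ []) ℚ-ring)

  0≤rise⁻¹ : ∀ x l → 0ℚ ≤ rise⁻¹ x l
  0≤rise⁻¹ x zero    = nonNegative⁻¹ 1ℚ
  0≤rise⁻¹ x (suc l) = 0≤* (0≤rise⁻¹ x l) (0≤inv (l ℕ.+ x))

  -- Consequences of the recurrence for q: the functions d and the particular solutions

  module Chain (n′ k : ℕ) (q : ℕ → ℕ → ℚ)
    (q-step : ∀ m r → m ℕ.< suc n′ →
              ι (suc m) * q m r ≡ (ι (suc m) - ι r) * q (suc m) r + ι (suc r) * q (suc m) (suc r))
    (0≤q : ∀ m r → 0ℚ ≤ q m r) where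

    F E : ℕ → ℕ → ℚ
    F m zero    = 0ℚ
    F m (suc r) = F m r + q m r
    E m zero    = 0ℚ
    E m (suc r) = E m r + ι r * q m r

    -- The sum of q (i + 1) 1 / (i (i + 1)) over i from 1 to x. It is what the inner sum of `d`
    -- becomes after division by the binomial coefficient of n over k.
    J : ℕ → ℚ
    J zero    = 0ℚ
    J (suc x) = J x + q (suc (suc x)) 1 * (inv (suc x) * inv x)

    -- The function d of the statement, rewritten in terms of q.
    dq : ℕ → ℕ → ℚ
    dq 0             x = - 1ℚ + ι k * ι x * inv n′ + q (suc x) 0 + ι x * J x
    dq 1             x = - (ι k * inv n′) - J x
    dq (suc (suc l)) x = E (2 ℕ.+ l ℕ.+ x) (2 ℕ.+ l) * (inv (suc l) * inv l) * rise⁻¹ x (2 ℕ.+ l)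

    -- Summed over r, the terms of `q-step` telescope up to a boundary term. In `E-step` the
    -- additional weight r lowers one coefficient from m + 1 to m and turns the boundary term into r
    -- (r - 1) q.
    F-step : ∀ m r → m ℕ.< suc n′ → ι (suc m) * F m r ≡ ι (suc m) * F (suc m) r + ι r * q (suc m) r
    F-step m zero    m<n = alg (ι m) (q (suc m) 0)
      where
      alg : ∀ a p → (1ℚ + a) * 0ℚ ≡ (1ℚ + a) * 0ℚ + 0ℚ * p
      alg = solve-∀ ℚ-ring
    F-step m (suc r) m<n =
      alg (ι (suc m)) (ι r) (F m r) (F (suc m) r) (q m r) (q (suc m) r) (q (suc m) (suc r)) (F-step m r m<n) (q-step m r m<n)
      where
      alg : ∀ a b f f′ p p′ p″ → a * f ≡ a * f′ + b * p′ → a * p ≡ (a - b) * p′ + (1ℚ + b) * p″ →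
            a * (f + p) ≡ a * (f′ + p′) + (1ℚ + b) * p″
      alg a b f f′ p p′ p″ h h′ = lincomb₂ 1ℚ 1ℚ h h′ (solve (a ∷ b ∷ f ∷ f′ ∷ p ∷ p′ ∷ p″ ∷ []) ℚ-ring)

    E-step : ∀ m r → m ℕ.< suc n′ →
             ι (suc m) * E m r ≡ ι m * E (suc m) r + ι r * (ι r - 1ℚ) * q (suc m) r
    E-step m zero    m<n = alg (ι m) (q (suc m) 0)
      where
      alg : ∀ a p → (1ℚ + a) * 0ℚ ≡ a * 0ℚ + 0ℚ * (0ℚ - 1ℚ) * p
      alg = solve-∀ ℚ-ring
    E-step m (suc r) m<n =
      alg (ι m) (ι r) (E m r) (E (suc m) r) (q m r) (q (suc m) r) (q (suc m) (suc r)) (E-step m r m<n) (q-step m r m<n)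
      where
      alg : ∀ a b f f′ p p′ p″ → (1ℚ + a) * f ≡ a * f′ + b * (b - 1ℚ) * p′ →
            (1ℚ + a) * p ≡ (1ℚ + a - b) * p′ + (1ℚ + b) * p″ →
            (1ℚ + a) * (f + b * p) ≡ a * (f′ + b * p′) + (1ℚ + b) * (1ℚ + b - 1ℚ) * p″
      alg a b f f′ p p′ p″ h h′ = lincomb₂ 1ℚ b h h′ (solve (a ∷ b ∷ f ∷ f′ ∷ p ∷ p′ ∷ p″ ∷ []) ℚ-ring)

    dq₀-step : ∀ x → suc x ℕ.< suc n′ → dq 0 x - dq 0 (suc x) ≡ ι 1 * dq 1 x
    dq₀-step x x<n =
      alg (ι k) (ι x) (inv n′) (J x) (q (suc x) 0) (q (2 ℕ.+ x) 0) (q (2 ℕ.+ x) 1) (inv x) (inv (suc x))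
          (q-step (suc x) 0 x<n) (inv-inverse (suc x)) (inv-inverse x)
      where
      alg : ∀ c a v j p p0 p1 i0 i1 → (1ℚ + (1ℚ + a)) * p ≡ (1ℚ + (1ℚ + a) - 0ℚ) * p0 + (1ℚ + 0ℚ) * p1 →
            i1 * (1ℚ + (1ℚ + a)) ≡ 1ℚ → i0 * (1ℚ + a) ≡ 1ℚ →
            (- 1ℚ + c * a * v + p + a * j) - (- 1ℚ + c * (1ℚ + a) * v + p0 + (1ℚ + a) * (j + p1 * (i1 * i0)))
            ≡ (1ℚ + 0ℚ) * (- (c * v) - j)
      alg c a v j p p0 p1 i0 i1 h h1 h0 = lincomb₃ i1 (- (p - p0)) (- (p1 * i1)) h h1 h0
        (solve (c ∷ a ∷ v ∷ j ∷ p ∷ p0 ∷ p1 ∷ i0 ∷ i1 ∷ []) ℚ-ring)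

    dq₁-step : ∀ x → dq 1 x - dq 1 (suc x) ≡ ι 2 * dq 2 x
    dq₁-step x = alg (ι k * inv n′) (J x) (q (2 ℕ.+ x) 0) (q (2 ℕ.+ x) 1) (inv x) (inv (suc x)) (inv 1) (inv-inverse 1)
      where
      alg : ∀ c j p0 p1 i0 i1 h → h * (1ℚ + (1ℚ + 0ℚ)) ≡ 1ℚ →
            (- c - j) - (- c - (j + p1 * (i1 * i0)))
            ≡ (1ℚ + (1ℚ + 0ℚ)) * ((0ℚ + 0ℚ * p0 + (1ℚ + 0ℚ) * p1) * (h * 1ℚ) * (1ℚ * i0 * i1))
      alg c j p0 p1 i0 i1 h eq = lincomb₁ (- (p1 * i1 * i0)) eq (solve (c ∷ j ∷ p0 ∷ p1 ∷ i0 ∷ i1 ∷ h ∷ []) ℚ-ring)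

    -- The next two lemmas extract from dq (2 + l) x and dq (2 + l) (suc x) the common factor rise⁻¹ x (3 + l).
    dq-expand : ∀ l x → dq (2 ℕ.+ l) x ≡
      E (2 ℕ.+ l ℕ.+ x) (2 ℕ.+ l) * (inv (suc l) * inv l) * (ι (3 ℕ.+ l ℕ.+ x) * rise⁻¹ x (3 ℕ.+ l))
    dq-expand l x = cong (λ r → E (2 ℕ.+ l ℕ.+ x) (2 ℕ.+ l) * (inv (suc l) * inv l) * r) (rise⁻¹-shrink x (2 ℕ.+ l))

    dq-expand-suc : ∀ l x → dq (2 ℕ.+ l) (suc x) ≡
      E (3 ℕ.+ l ℕ.+ x) (2 ℕ.+ l) * (inv (suc l) * inv l) * (ι (suc x) * rise⁻¹ x (3 ℕ.+ l))
    dq-expand-suc l x = cong₂ (λ m r → E (2 ℕ.+ m) (2 ℕ.+ l) * (inv (suc l) * inv l) * r)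
                              (ℕ.+-suc l x) (rise⁻¹-suc x (2 ℕ.+ l))

    dq-step : ∀ l x → suc l ℕ.+ x ℕ.< suc n′ → dq (suc l) x - dq (suc l) (suc x) ≡ ι (2 ℕ.+ l) * dq (2 ℕ.+ l) x
    dq-step zero    x _   = dq₁-step x
    dq-step (suc l) x m<n = trans (cong₂ _-_ (dq-expand l x) (dq-expand-suc l x))
      (alg (ι x) (ι l) (ι (l ℕ.+ x)) (E (2 ℕ.+ l ℕ.+ x) (2 ℕ.+ l)) (E (3 ℕ.+ l ℕ.+ x) (2 ℕ.+ l)) (q (3 ℕ.+ l ℕ.+ x) (2 ℕ.+ l))
           (rise⁻¹ x (3 ℕ.+ l)) (inv l) (inv (suc l)) (inv (2 ℕ.+ l))
           (ι-+ l x) (E-step (2 ℕ.+ l ℕ.+ x) (2 ℕ.+ l) m<n) (inv-inverse l) (inv-inverse (2 ℕ.+ l)))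
      where
      alg : ∀ a b s e e′ p r i0 i1 i2 → s ≡ b + a →
            (1ℚ + (1ℚ + (1ℚ + s))) * e ≡ (1ℚ + (1ℚ + s)) * e′ + (1ℚ + (1ℚ + b)) * (1ℚ + (1ℚ + b) - 1ℚ) * p →
            i0 * (1ℚ + b) ≡ 1ℚ → i2 * (1ℚ + (1ℚ + (1ℚ + b))) ≡ 1ℚ →
            e * (i1 * i0) * ((1ℚ + (1ℚ + (1ℚ + s))) * r) - e′ * (i1 * i0) * ((1ℚ + a) * r)
            ≡ (1ℚ + (1ℚ + (1ℚ + b))) * ((e′ + (1ℚ + (1ℚ + b)) * p) * (i2 * i1) * r)
      alg a b s e e′ p r i0 i1 i2 refl h h0 h2 =
        lincomb₃ (i1 * i0 * r) (i1 * r * (e′ + (1ℚ + (1ℚ + b)) * p)) (- (i1 * r * (e′ + (1ℚ + (1ℚ + b)) * p))) h h0 h2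
          (solve (a ∷ b ∷ e ∷ e′ ∷ p ∷ r ∷ i0 ∷ i1 ∷ i2 ∷ []) ℚ-ring)

    0≤E : ∀ m r → 0ℚ ≤ E m r
    0≤E m zero    = ≤-refl
    0≤E m (suc r) = 0≤+ (0≤E m r) (0≤* (0≤ι r) (0≤q m r))

    0≤dq : ∀ l x → 0ℚ ≤ dq (2 ℕ.+ l) x
    0≤dq l x = 0≤* (0≤* (0≤E (2 ℕ.+ l ℕ.+ x) (2 ℕ.+ l)) (0≤* (0≤inv (suc l)) (0≤inv l))) (0≤rise⁻¹ x (2 ℕ.+ l))

    -- By `dq-step` the decrement is a nonnegative multiple of the next function, which is itself
    -- nonnegative.
    dq-antitone : ∀ l x → suc l ℕ.+ x ℕ.< suc n′ → dq (suc l) (suc x) ≤ dq (suc l) x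
    dq-antitone l x m<n = ≤-by (0≤* (0≤ι (2 ℕ.+ l)) (0≤dq l x)) (dq-step l x m<n)

    -- With dq-step this gives t l ≤ t (suc l) + 1, that is, t l + l − 1 is nondecreasing in l.
    dq-ratio : ∀ l x → suc l ℕ.+ x ℕ.< suc n′ →
               ι (suc l ℕ.+ x) * dq (suc l) (suc x) ≤ ι (suc x) * dq (suc l) x
    dq-ratio zero    x m<n = *-monoˡ-≤-nonNeg (ι (suc x)) {{ι-nonNeg (suc x)}} (dq-antitone 0 x m<n)
    -- After the common factor is taken out, the difference of the two sides is the boundary term r
    -- (r - 1) q of `E-step`.
    dq-ratio (suc l) x m<n = ≤-by
      (0≤* (0≤* (0≤ι (2 ℕ.+ l)) (0≤* (0≤ι (suc l)) (0≤q (3 ℕ.+ l ℕ.+ x) (2 ℕ.+ l))))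
           (0≤* (0≤ι (suc x)) (0≤* (0≤* (0≤inv (suc l)) (0≤inv l)) (0≤rise⁻¹ x (3 ℕ.+ l)))))
      (trans (cong₂ (λ d d′ → ι (suc x) * d - ι (2 ℕ.+ l ℕ.+ x) * d′) (dq-expand l x) (dq-expand-suc l x))
        (alg (ι (suc x)) (ι l) (ι (2 ℕ.+ l ℕ.+ x)) (E (2 ℕ.+ l ℕ.+ x) (2 ℕ.+ l)) (E (3 ℕ.+ l ℕ.+ x) (2 ℕ.+ l))
             (q (3 ℕ.+ l ℕ.+ x) (2 ℕ.+ l)) (rise⁻¹ x (3 ℕ.+ l)) (inv (suc l) * inv l) (E-step (2 ℕ.+ l ℕ.+ x) (2 ℕ.+ l) m<n)))
      where
      alg : ∀ a b m e e′ p r i →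
            (1ℚ + m) * e ≡ m * e′ + (1ℚ + (1ℚ + b)) * (1ℚ + (1ℚ + b) - 1ℚ) * p →
            a * (e * i * ((1ℚ + m) * r)) - m * (e′ * i * (a * r))
            ≡ ((1ℚ + (1ℚ + b)) * ((1ℚ + b) * p)) * (a * (i * r))
      alg a b m e e′ p r i h = lincomb₁ (a * i * r) h (solve (a ∷ b ∷ m ∷ e ∷ e′ ∷ p ∷ r ∷ i ∷ []) ℚ-ring)

    -- With [m]ₗ the falling factorial, which is rise x l for m = l + x, the functions A l m − w [m]ₗ
    -- are the solutions of the recurrence for the probability of success after passing over the
    -- first m candidates, as long as the l best so far are acceptable.
    A : ℕ → ℕ → ℚ
    A 0             m = 0ℚ
    A 1             m = - dq 0 m
    A (suc (suc l)) m = 1ℚ - F m (2 ℕ.+ l) + E m (2 ℕ.+ l) * inv l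

    -- For l ≥ 2 this is 1/(l - 1) - 1/l = 1/(l (l - 1)), the prefactor in `dq`; the term for r = l
    -- contributes equally to both sides. Together with `rise-suc`, the identity at x = t (suc l)
    -- yields the recursion of `W`.
    A-next : ∀ l x → l ℕ.+ x ℕ.< suc n′ → A (suc l) (l ℕ.+ x) ≡ A l (l ℕ.+ x) - rise x l * dq l x
    A-next 0 x m<n = alg (dq 0 x)
      where
      alg : ∀ y → - y ≡ 0ℚ - 1ℚ * y
      alg = solve-∀ ℚ-ring
    A-next 1 x m<n =
      alg (ι k) (ι x) (inv n′) (J x) (q (suc x) 0) (q (suc x) 1) (q (2 ℕ.+ x) 0) (q (2 ℕ.+ x) 1) (inv x) (inv (suc x))
          (q-step (suc x) 0 m<n) (inv-inverse (suc x)) (inv-inverse x)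
      where
      alg : ∀ c a v j p p₁ p0 p1 i0 i1 → (1ℚ + (1ℚ + a)) * p ≡ (1ℚ + (1ℚ + a) - 0ℚ) * p0 + (1ℚ + 0ℚ) * p1 →
            i1 * (1ℚ + (1ℚ + a)) ≡ 1ℚ → i0 * (1ℚ + a) ≡ 1ℚ →
            1ℚ - (0ℚ + p + p₁) + (0ℚ + 0ℚ * p + (1ℚ + 0ℚ) * p₁) * 1ℚ ≡
            - (- 1ℚ + c * (1ℚ + a) * v + p0 + (1ℚ + a) * (j + p1 * (i1 * i0))) - 1ℚ * (1ℚ + a) * (- (c * v) - j)
      alg c a v j p p₁ p0 p1 i0 i1 h h1 h0 = lincomb₃ (- i1) (p - p0) (p1 * i1) h h1 h0
        (solve (c ∷ a ∷ v ∷ j ∷ p ∷ p₁ ∷ p0 ∷ p1 ∷ i0 ∷ i1 ∷ []) ℚ-ring)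
    A-next (suc (suc l)) x m<n =
      alg (ι l) (F (2 ℕ.+ l ℕ.+ x) (2 ℕ.+ l)) (E (2 ℕ.+ l ℕ.+ x) (2 ℕ.+ l)) (q (2 ℕ.+ l ℕ.+ x) (2 ℕ.+ l))
          (rise x (2 ℕ.+ l)) (rise⁻¹ x (2 ℕ.+ l)) (inv l) (inv (suc l))
          (rise-rise⁻¹ x (2 ℕ.+ l)) (inv-inverse l) (inv-inverse (suc l))
      where
      alg : ∀ b f e p r r⁻¹ i0 i1 → r * r⁻¹ ≡ 1ℚ → i0 * (1ℚ + b) ≡ 1ℚ → i1 * (1ℚ + (1ℚ + b)) ≡ 1ℚ →
            1ℚ - (f + p) + (e + (1ℚ + (1ℚ + b)) * p) * i1 ≡ 1ℚ - f + e * i0 - r * (e * (i1 * i0) * r⁻¹)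
      alg b f e p r r⁻¹ i0 i1 h h0 h1 = lincomb₃ (e * i1 * i0) (- (e * i1)) (e * i0 + p) h h0 h1
        (solve (b ∷ f ∷ e ∷ p ∷ r ∷ r⁻¹ ∷ i0 ∷ i1 ∷ []) ℚ-ring)

    -- The probability that the candidate of relative rank suc r among the first m has rank at most k.
    P : ℕ → ℕ → ℚ
    P m r = 1ℚ - F m (suc r)

    ∑P : ℕ → ℕ → ℚ
    ∑P m zero    = 0ℚ
    ∑P m (suc l) = ∑P m l + P m l

    -- Read probabilistically, both sides are the expectation of min(R, l), with R the number of the
    -- k best among the first m candidates.
    ∑P-closed : ∀ m l → ∑P m l ≡ ι l - ι l * F m l + E m l
    ∑P-closed m zero    = refl
    ∑P-closed m (suc l) = trans (cong (_+ P m l) (∑P-closed m l)) (alg (ι l) (F m l) (E m l) (q m l))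
      where
      alg : ∀ b f e p → b - b * f + e + (1ℚ - (f + p)) ≡ (1ℚ + b) - (1ℚ + b) * (f + p) + (e + b * p)
      alg = solve-∀ ℚ-ring

    -- Of the `suc m` equally likely relative ranks of the next candidate, l are acceptable and
    -- contribute `∑P`; the remaining ones lead to time `suc m`.
    A-step : ∀ l m → suc m ℕ.< suc n′ →
             ι (suc m) * A l m ≡ ∑P (suc m) l + (ι (suc m) - ι l) * A l (suc m)
    A-step 0 m m<n = alg (ι m)
      where
      alg : ∀ a → (1ℚ + a) * 0ℚ ≡ 0ℚ + (1ℚ + a - 0ℚ) * 0ℚ
      alg = solve-∀ ℚ-ring
    A-step 1 m m<n =
      alg (ι k) (ι m) (inv n′) (J m) (q (suc m) 0) (q (2 ℕ.+ m) 0) (q (2 ℕ.+ m) 1) (inv m) (inv (suc m))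
          (q-step (suc m) 0 m<n) (inv-inverse (suc m)) (inv-inverse m)
      where
      alg : ∀ c a v j p p0 p1 i0 i1 → (1ℚ + (1ℚ + a)) * p ≡ (1ℚ + (1ℚ + a) - 0ℚ) * p0 + (1ℚ + 0ℚ) * p1 →
            i1 * (1ℚ + (1ℚ + a)) ≡ 1ℚ → i0 * (1ℚ + a) ≡ 1ℚ →
            (1ℚ + a) * - (- 1ℚ + c * a * v + p + a * j) ≡
            0ℚ + (1ℚ - (0ℚ + p)) +
            (1ℚ + a - (1ℚ + 0ℚ)) * - (- 1ℚ + c * (1ℚ + a) * v + p0 + (1ℚ + a) * (j + p1 * (i1 * i0)))
      alg c a v j p p0 p1 i0 i1 h h1 h0 = lincomb₃ (- (a * i1)) (a * (p - p0)) (a * p1 * i1) h h1 h0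
        (solve (c ∷ a ∷ v ∷ j ∷ p ∷ p0 ∷ p1 ∷ i0 ∷ i1 ∷ []) ℚ-ring)
    A-step (suc (suc l)) m m<n = trans
      (alg (ι m) (ι l) (F m (2 ℕ.+ l)) (F (suc m) (2 ℕ.+ l)) (E m (2 ℕ.+ l)) (E (suc m) (2 ℕ.+ l)) (q (suc m) (2 ℕ.+ l)) (inv l)
           (F-step m (2 ℕ.+ l) (ℕ.<-trans (ℕ.n<1+n m) m<n)) (E-step m (2 ℕ.+ l) (ℕ.<-trans (ℕ.n<1+n m) m<n)) (inv-inverse l))
      (cong (_+ (ι (suc m) - ι (2 ℕ.+ l)) * A (2 ℕ.+ l) (suc m)) (sym (∑P-closed (suc m) (2 ℕ.+ l))))
      where
      alg : ∀ a b f f′ e e′ p i → (1ℚ + a) * f ≡ (1ℚ + a) * f′ + (1ℚ + (1ℚ + b)) * p →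
            (1ℚ + a) * e ≡ a * e′ + (1ℚ + (1ℚ + b)) * (1ℚ + (1ℚ + b) - 1ℚ) * p →
            i * (1ℚ + b) ≡ 1ℚ →
            (1ℚ + a) * (1ℚ - f + e * i) ≡
            (1ℚ + (1ℚ + b)) - (1ℚ + (1ℚ + b)) * f′ + e′ + (1ℚ + a - (1ℚ + (1ℚ + b))) * (1ℚ - f′ + e′ * i)
      alg a b f f′ e e′ p i hf he hi = lincomb₃ (- 1ℚ) i (e′ + (1ℚ + (1ℚ + b)) * p) hf he hi
        (solve (a ∷ b ∷ f ∷ f′ ∷ e ∷ e′ ∷ p ∷ i ∷ []) ℚ-ring)

    -- The next candidate falls into one of `suc m` equally likely places; `suc r` of them lie above
    -- the candidate of relative rank `suc r` and push it down by one.
    P-step : ∀ m r → m ℕ.< suc n′ → ι (suc m) * P m r ≡ ι (suc r) * P (suc m) (suc r) + (ι (suc m) - ι (suc r)) * P (suc m) r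
    P-step m r m<n =
      alg (ι (suc m)) (ι (suc r)) (F m (suc r)) (F (suc m) (suc r)) (q (suc m) (suc r)) (F-step m (suc r) m<n)
      where
      alg : ∀ a b f f′ p → a * f ≡ a * f′ + b * p → a * (1ℚ - f) ≡ b * (1ℚ - (f′ + p)) + (a - b) * (1ℚ - f′)
      alg a b f f′ p h = lincomb₁ (- 1ℚ) h (solve (a ∷ b ∷ f ∷ f′ ∷ p ∷ []) ℚ-ring)

    -- Values at the last two times

    module Boundary (1≤k : 1 ℕ.≤ k) (k≤n′ : k ℕ.≤ n′)
      (q-below : ∀ j → j ℕ.< k → q (suc n′) j ≡ 0ℚ) (q-at : q (suc n′) k ≡ 1ℚ)
      (q-above : ∀ j → k ℕ.< j → q (suc n′) j ≡ 0ℚ)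
      (δ : ℚ) (δ-one : k ≡ 1 → δ ≡ - J n′) (0≤δ : 2 ℕ.≤ k → 0ℚ ≤ δ)
      (δ-rise : 2 ℕ.≤ k → δ * rise (n′ ℕ.∸ k) k ≡ 1ℚ - ι k * inv n′) where

      F-below : ∀ r → r ℕ.≤ k → F (suc n′) r ≡ 0ℚ
      F-below zero    _   = refl
      F-below (suc r) r<k = cong₂ _+_ (F-below r (ℕ.<⇒≤ r<k)) (q-below r r<k)

      E-below : ∀ r → r ℕ.≤ k → E (suc n′) r ≡ 0ℚ
      E-below zero    _   = refl
      E-below (suc r) r<k = cong₂ _+_ (E-below r (ℕ.<⇒≤ r<k)) (trans (cong (ι r *_) (q-below r r<k)) (*-zeroʳ (ι r)))

      F-above : ∀ r → k ℕ.< r → F (suc n′) r ≡ 1ℚ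
      F-above (suc r) (s≤s k≤r) with ℕ.m≤n⇒m<n∨m≡n k≤r
      ... | inj₁ k<r  = cong₂ _+_ (F-above r k<r) (q-above r k<r)
      ... | inj₂ refl = cong₂ _+_ (F-below k ℕ.≤-refl) q-at

      P-last-success : ∀ r → r ℕ.< k → P (suc n′) r ≡ 1ℚ
      P-last-success r r<k = cong (λ p → 1ℚ - p) (F-below (suc r) r<k)

      P-last-failure : ∀ r → k ℕ.≤ r → P (suc n′) r ≡ 0ℚ
      P-last-failure r k≤r = cong (λ p → 1ℚ - p) (F-above (suc r) (s≤s k≤r))

      -- Fewer than k of the k best are among the first n′ exactly when the last candidate is one of
      -- them. There are then k - 1 of them among the first n′, whence `E-penultimate`.
      F-penultimate : F n′ k ≡ ι k * inv n′
      F-penultimate = alg (ι (suc n′)) (inv n′) (ι k) (F n′ k)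
        (trans (F-step n′ k ℕ.≤-refl)
               (cong₂ (λ f p → ι (suc n′) * f + ι k * p) (F-below k ℕ.≤-refl) q-at))
        (inv-inverse n′)
        where
        alg : ∀ a v c f → a * f ≡ a * 0ℚ + c * 1ℚ → v * a ≡ 1ℚ → f ≡ c * v
        alg a v c f h h′ = lincomb₂ v (- f) h h′ (solve (a ∷ v ∷ c ∷ f ∷ []) ℚ-ring)

      E-penultimate : E n′ k ≡ ι k * (ι k - 1ℚ) * inv n′
      E-penultimate = alg (ι n′) (inv n′) (ι k) (E n′ k)
        (trans (E-step n′ k ℕ.≤-refl)
               (cong₂ (λ e p → ι n′ * e + ι k * (ι k - 1ℚ) * p) (E-below k ℕ.≤-refl) q-at))
        (inv-inverse n′)
        where
        alg : ∀ a v c e → (1ℚ + a) * e ≡ a * 0ℚ + c * (c - 1ℚ) * 1ℚ → v * (1ℚ + a) ≡ 1ℚ → e ≡ c * (c - 1ℚ) * v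
        alg a v c e h h′ = lincomb₂ v (- e) h h′ (solve (a ∷ v ∷ c ∷ e ∷ []) ℚ-ring)

      A-last-one : k ≡ 1 → A 1 n′ ≡ ι 1 * inv n′ + δ * rise (n′ ℕ.∸ 1) 1
      A-last-one refl =
        alg (ι n′) (inv n′) (J n′) δ (q (suc n′) 0) (ι (suc (n′ ℕ.∸ 1))) (q-below 0 ℕ.≤-refl) (δ-one refl)
            (cong ι (ℕ.m+[n∸m]≡n k≤n′)) (inv-inverse n′)
        where
        alg : ∀ a v j d p a′ → p ≡ 0ℚ → d ≡ - j → a′ ≡ a → v * (1ℚ + a) ≡ 1ℚ →
              - (- 1ℚ + (1ℚ + 0ℚ) * a * v + p + a * j) ≡ (1ℚ + 0ℚ) * v + d * (1ℚ * a′)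
        alg a v j d p a′ refl refl refl h = lincomb₁ (- 1ℚ) h (solve (a ∷ v ∷ j ∷ []) ℚ-ring)

      -- At least k - 1 of the k best are among the first n′, so min(1, R / (k - 1)) is always 1 and
      -- `A k n′` equals 1; what remains is `δ-rise`.
      A-last-two : ∀ l → k ≡ 2 ℕ.+ l → A (2 ℕ.+ l) n′ ≡ ι (2 ℕ.+ l) * inv n′ + δ * rise (n′ ℕ.∸ (2 ℕ.+ l)) (2 ℕ.+ l)
      A-last-two l refl =
        alg (ι l) (inv n′) (inv l) (F n′ k) (E n′ k) (δ * rise (n′ ℕ.∸ k) k)
            F-penultimate E-penultimate (δ-rise (s≤s (s≤s z≤n))) (inv-inverse l)
        where
        alg : ∀ b v i f e d → f ≡ (1ℚ + (1ℚ + b)) * v → e ≡ (1ℚ + (1ℚ + b)) * (1ℚ + (1ℚ + b) - 1ℚ) * v →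
              d ≡ 1ℚ - (1ℚ + (1ℚ + b)) * v → i * (1ℚ + b) ≡ 1ℚ →
              1ℚ - f + e * i ≡ (1ℚ + (1ℚ + b)) * v + d
        alg b v i f e d refl refl refl h = lincomb₁ ((1ℚ + (1ℚ + b)) * v) h (solve (b ∷ v ∷ i ∷ []) ℚ-ring)

      -- This equation fixes `δ`: when all but the last candidate have been passed over, success has
      -- probability k / n, and `δ` is the parameter for which the solution with l = k takes this
      -- value.
      A-last : A k n′ ≡ ι k * inv n′ + δ * rise (n′ ℕ.∸ k) k
      A-last = cases k refl 1≤k
        where
        cases : ∀ l → k ≡ l → 1 ℕ.≤ l → A l n′ ≡ ι l * inv n′ + δ * rise (n′ ℕ.∸ l) l
        cases 1             eq _ = A-last-one eq
        cases (suc (suc l)) eq _ = A-last-two l eq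

      -- Here x is n - k, the end of the range for l = k, so that a least solution exists there. For
      -- k ≥ 2 the left side vanishes, because at time n all the k best have arrived; for k = 1 the
      -- sides differ by 1/n.
      dq-top : ∀ x → k ℕ.+ x ≡ suc n′ → ι k * dq k x ≤ δ
      dq-top x = cases k refl 1≤k
        where
        cases : ∀ l → k ≡ l → 1 ℕ.≤ l → l ℕ.+ x ≡ suc n′ → ι l * dq l x ≤ δ
        cases 1             refl _ refl = ≤-by (0≤inv n′)
          (trans (cong (λ d → d - ι 1 * dq 1 n′) (δ-one refl)) (alg (inv n′) (J n′)))
          where
          alg : ∀ v j → - j - (1ℚ + 0ℚ) * (- ((1ℚ + 0ℚ) * v) - j) ≡ v
          alg = solve-∀ ℚ-ring
        cases (suc (suc l)) refl _ eq   = subst (_≤ δ) (sym (begin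
          ι k * (E (k ℕ.+ x) k * c * r)      ≡⟨ cong (λ m → ι k * (E m k * c * r)) eq ⟩
          ι k * (E (suc n′) k * c * r)       ≡⟨ cong (λ e → ι k * (e * c * r)) (E-below k ℕ.≤-refl) ⟩
          ι k * (0ℚ * c * r)                 ≡⟨ alg (ι k) c r ⟩
          0ℚ                                 ∎)) (0≤δ (s≤s (s≤s z≤n)))
          where
          open ≡-Reasoning
          c r : ℚ
          c = inv (suc l) * inv l
          r = rise⁻¹ x (2 ℕ.+ l)
          alg : ∀ a c r → a * (0ℚ * c * r) ≡ 0ℚ
          alg = solve-∀ ℚ-ring

  -- Subtraction of natural numbers

  private
    sub : ∀ {m j} → j ℕ.≤ m → + m ℤ.- + j ≡ + (m ∸ j)
    sub {m} {j} j≤m = trans (ℤ.m-n≡m⊖n m j) (ℤ.⊖-≥ j≤m)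

    sub₂ : ∀ {m j} → suc j ℕ.≤ m → + m ℤ.- + j ℤ.- 1ℤ ≡ + (m ∸ suc j)
    sub₂ {m} {j} j<m = begin
      + m ℤ.- + j ℤ.- 1ℤ   ≡⟨ cong (ℤ._- 1ℤ) (sub (ℕ.<⇒≤ j<m)) ⟩
      + (m ∸ j) ℤ.- 1ℤ     ≡⟨ sub (ℕ.m<n⇒0<n∸m j<m) ⟩
      + (m ∸ j ∸ 1)        ≡⟨ cong +_ (trans (ℕ.∸-+-assoc m j 1) (cong (m ∸_) (ℕ.+-comm j 1))) ⟩
      + (m ∸ suc j)        ∎
      where open ≡-Reasoning

  ∸-suc-! : ∀ {m n} → m ℕ.< n → (n ∸ m) ! ≡ (n ∸ m) ℕ.* (n ∸ suc m) !
  ∸-suc-! {zero}  {suc n} _         = refl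
  ∸-suc-! {suc m} {suc n} (s≤s m<n) = ∸-suc-! m<n

  ι-∸ : ∀ {m n} → m ℕ.≤ n → ι (n ∸ m) ≡ ι n - ι m
  ι-∸ {m} {n} m≤n = begin
    ι (n ∸ m)                  ≡⟨ alg (ι (n ∸ m)) (ι m) ⟩
    (ι m + ι (n ∸ m)) - ι m    ≡⟨ cong (_- ι m) (ι-+ m (n ∸ m)) ⟨
    ι (m ℕ.+ (n ∸ m)) - ι m    ≡⟨ cong (λ p → ι p - ι m) (ℕ.m+[n∸m]≡n m≤n) ⟩
    ι n - ι m                  ∎
    where
    open ≡-Reasoning
    alg : ∀ a b → a ≡ (b + a) - b
    alg = solve-∀ ℚ-ring

  !-nonZero : ∀ m → ℚ.NonZero (ι (m !))
  !-nonZero m = ι-nonZero (m !) {{m ℕ.!≢0}}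

  -- Falling factorials and binomial coefficients

  falling : ℕ → ℕ → ℚ
  falling m j = ℤ→ℚ (fallingFactorial (+ m) j)

  choose : ℕ → ℕ → ℚ
  choose m j = binomial (+ m) (+ j)

  choose-! : ∀ m j → choose m j * ι (j !) ≡ falling m j
  choose-! m j = /-*-cancel (fallingFactorial (+ m) j) (j !) {{j ℕ.!≢0}}

  fallingFactorial-+ : ∀ i a b → fallingFactorial i (b ℕ.+ a) ≡ fallingFactorial i a ℤ.* fallingFactorial (i ℤ.- + a) b
  fallingFactorial-+ i a zero    = sym (ℤ.*-identityʳ _)
  fallingFactorial-+ i a (suc b) = trans
    (cong₂ ℤ._*_ (cong (λ j → i ℤ.- j) (ℤ.pos-+ b a)) (fallingFactorial-+ i a b))
    (alg i (+ a) (+ b) (fallingFactorial i a) (fallingFactorial (i ℤ.- + a) b))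
    where
    alg : ∀ i a b x y → (i ℤ.- (b ℤ.+ a)) ℤ.* (x ℤ.* y) ≡ x ℤ.* ((i ℤ.- a ℤ.- b) ℤ.* y)
    alg = ℤSolver.solve-∀

  falling-+ : ∀ {n a} b → a ℕ.≤ n → falling n (b ℕ.+ a) ≡ falling n a * falling (n ∸ a) b
  falling-+ {n} {a} b a≤n = begin
    ℤ→ℚ (fallingFactorial (+ n) (b ℕ.+ a))
      ≡⟨ cong ℤ→ℚ (fallingFactorial-+ (+ n) a b) ⟩
    ℤ→ℚ (fallingFactorial (+ n) a ℤ.* fallingFactorial (+ n ℤ.- + a) b)
      ≡⟨ ℤ→ℚ-* (fallingFactorial (+ n) a) (fallingFactorial (+ n ℤ.- + a) b) ⟩
    falling n a * ℤ→ℚ (fallingFactorial (+ n ℤ.- + a) b)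
      ≡⟨ cong (λ i → falling n a * ℤ→ℚ (fallingFactorial i b)) (sub a≤n) ⟩
    falling n a * falling (n ∸ a) b ∎
    where open ≡-Reasoning

  falling-suc : ∀ m j → falling m (suc j) ≡ (ι m - ι j) * falling m j
  falling-suc m j = begin
    ℤ→ℚ ((+ m ℤ.- + j) ℤ.* fallingFactorial (+ m) j)  ≡⟨ ℤ→ℚ-* (+ m ℤ.- + j) (fallingFactorial (+ m) j) ⟩
    ℤ→ℚ (+ m ℤ.- + j) * falling m j                   ≡⟨ cong (_* falling m j) (ℤ→ℚ-+ (+ m) (ℤ.- + j)) ⟩
    (ℤ→ℚ (+ m) + ℤ→ℚ (ℤ.- + j)) * falling m j         ≡⟨ cong (λ p → (ℤ→ℚ (+ m) + p) * falling m j) (ℤ→ℚ-neg (+ j)) ⟩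
    (ℤ→ℚ (+ m) - ℤ→ℚ (+ j)) * falling m j             ≡⟨ cong₂ (λ p p′ → (p - p′) * falling m j) (ι≡/1 m) (ι≡/1 j) ⟨
    (ι m - ι j) * falling m j                         ∎
    where open ≡-Reasoning

  falling-! : ∀ {n} m → m ℕ.≤ n → falling n m * ι ((n ∸ m) !) ≡ ι (n !)
  falling-! {n} zero    _   = *-identityˡ (ι (n !))
  falling-! {n} (suc m) m<n = begin
    falling n (suc m) * ι ((n ∸ suc m) !)              ≡⟨ cong (_* ι ((n ∸ suc m) !)) (falling-suc n m) ⟩
    (ι n - ι m) * falling n m * ι ((n ∸ suc m) !)      ≡⟨ alg (ι n - ι m) (falling n m) (ι ((n ∸ suc m) !)) ⟩
    falling n m * ((ι n - ι m) * ι ((n ∸ suc m) !))    ≡⟨ cong (λ p → falling n m * (p * ι ((n ∸ suc m) !))) (ι-∸ (ℕ.<⇒≤ m<n)) ⟨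
    falling n m * (ι (n ∸ m) * ι ((n ∸ suc m) !))      ≡⟨ cong (falling n m *_) (ι-* (n ∸ m) ((n ∸ suc m) !)) ⟨
    falling n m * ι ((n ∸ m) ℕ.* (n ∸ suc m) !)        ≡⟨ cong (λ p → falling n m * ι p) (∸-suc-! m<n) ⟨
    falling n m * ι ((n ∸ m) !)                        ≡⟨ falling-! m (ℕ.<⇒≤ m<n) ⟩
    ι (n !)                                            ∎
    where
    open ≡-Reasoning
    alg : ∀ a b c → a * b * c ≡ b * (a * c)
    alg = solve-∀ ℚ-ring

  choose-step : ∀ m j → ι (suc j) * choose m (suc j) + ι j * choose m j ≡ ι m * choose m j
  choose-step m j = *-cancelʳ (ι (j !)) {{ !-nonZero j }}
    (alg (ι m) (ι j) (choose m j) (choose m (suc j)) (ι (j !)) (falling m j)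
      (trans (cong (choose m (suc j) *_) (sym (ι-* (suc j) (j !)))) (trans (choose-! m (suc j)) (falling-suc m j)))
      (choose-! m j))
    where
    alg : ∀ a b c c′ f g → c′ * ((1ℚ + b) * f) ≡ (a - b) * g → c * f ≡ g →
          ((1ℚ + b) * c′ + b * c) * f ≡ (a * c) * f
    alg a b c c′ f g h refl = lincomb₁ 1ℚ h (solve (a ∷ b ∷ c ∷ c′ ∷ f ∷ []) ℚ-ring)

  choose-absorb : ∀ m j → ι (suc m) * choose m j ≡ ι (suc j) * choose (suc m) (suc j)
  choose-absorb m j = *-cancelʳ (ι (j !)) {{ !-nonZero j }}
    (alg (ι (suc m)) (ι (suc j)) (choose m j) (choose (suc m) (suc j)) (ι (j !)) (falling m j)
      (trans (cong (choose (suc m) (suc j) *_) (sym (ι-* (suc j) (j !))))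
        (trans (choose-! (suc m) (suc j))
          (trans (cong (falling (suc m)) (ℕ.+-comm 1 j))
            (trans (falling-+ j (s≤s z≤n)) (cong (_* falling m j) (falling-one m))))))
      (choose-! m j))
    where
    falling-one : ∀ m → falling (suc m) 1 ≡ ι (suc m)
    falling-one m = trans (falling-suc (suc m) 0) (alg₁ (ι (suc m)))
      where
      alg₁ : ∀ a → (a - 0ℚ) * 1ℚ ≡ a
      alg₁ = solve-∀ ℚ-ring
    alg : ∀ a b c c′ f g → c′ * (b * f) ≡ a * g → c * f ≡ g → (a * c) * f ≡ (b * c′) * f
    alg a b c c′ f g h refl = lincomb₁ (- 1ℚ) h (solve (a ∷ b ∷ c ∷ c′ ∷ f ∷ []) ℚ-ring)

  choose-one : ∀ m → choose m 1 ≡ ι m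
  choose-one m = alg (choose m 1) (ι m) (choose-step m 0)
    where
    alg : ∀ c a → (1ℚ + 0ℚ) * c + 0ℚ * 1ℚ ≡ a * 1ℚ → c ≡ a
    alg c a h = lincomb₁ 1ℚ h (solve (c ∷ a ∷ []) ℚ-ring)

  fallingFactorial-zero : ∀ {m j} → m ℕ.< j → fallingFactorial (+ m) j ≡ 0ℤ
  fallingFactorial-zero {m} {suc j} (s≤s m≤j) with ℕ.m≤n⇒m<n∨m≡n m≤j
  ... | inj₁ m<j  = trans (cong ((+ m ℤ.- + j) ℤ.*_) (fallingFactorial-zero m<j)) (ℤ.*-zeroʳ (+ m ℤ.- + j))
  ... | inj₂ refl = cong (ℤ._* fallingFactorial (+ m) m) (ℤ.+-inverseʳ (+ m))

  choose-zero : ∀ {m j} → m ℕ.< j → choose m j ≡ 0ℚ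
  choose-zero {m} {j} m<j = trans (cong (λ i → _/_ i (j !) {{j ℕ.!≢0}}) (fallingFactorial-zero m<j)) (0/n≡0 (j !) {{j ℕ.!≢0}})

  choose-self : ∀ m → choose m m ≡ 1ℚ
  choose-self zero    = refl
  choose-self (suc m) = *-cancelʳ-ι (suc m) (begin
    choose (suc m) (suc m) * ι (suc m)   ≡⟨ *-comm _ (ι (suc m)) ⟩
    ι (suc m) * choose (suc m) (suc m)   ≡⟨ choose-absorb m m ⟨
    ι (suc m) * choose m m               ≡⟨ cong (ι (suc m) *_) (choose-self m) ⟩
    ι (suc m) * 1ℚ                       ≡⟨ *-comm (ι (suc m)) 1ℚ ⟩
    1ℚ * ι (suc m)                       ∎)
    where open ≡-Reasoning

  0≤choose : ∀ m j → 0ℚ ≤ choose m j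
  0≤choose m j with ℕ.≤-<-connex j m
  ... | inj₂ m<j = ≤-reflexive (sym (choose-zero m<j))
  ... | inj₁ j≤m rewrite fallingFactorial≡P′ j j≤m = nonNegative⁻¹ _ {{normalize-nonNeg (m P′ j) (j !) {{j ℕ.!≢0}}}}

  -- choose⁻ m i j is the binomial coefficient of m over i − j, where i − j may be negative.
  choose⁻ : ℕ → ℕ → ℕ → ℚ
  choose⁻ m i       zero    = choose m i
  choose⁻ m zero    (suc j) = 0ℚ
  choose⁻ m (suc i) (suc j) = choose⁻ m i j

  choose⁻-∸ : ∀ m {i j} → j ℕ.≤ i → choose⁻ m i j ≡ choose m (i ∸ j)
  choose⁻-∸ m {i}     z≤n       = refl
  choose⁻-∸ m {suc i} (s≤s j≤i) = choose⁻-∸ m j≤i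

  0≤choose⁻ : ∀ m i j → 0ℚ ≤ choose⁻ m i j
  0≤choose⁻ m i       zero    = 0≤choose m i
  0≤choose⁻ m zero    (suc j) = ≤-refl
  0≤choose⁻ m (suc i) (suc j) = 0≤choose⁻ m i j

  -- This is `choose-step` at the lower index i - j, with the multiples of j moved to the right so
  -- that all factors are natural numbers.
  choose⁻-step : ∀ m i j → ι (suc i) * choose⁻ m (suc i) j + ι i * choose⁻ m i j ≡
                 ι m * choose⁻ m i j + ι j * (choose⁻ m i j + choose⁻ m (suc i) j)
  choose⁻-step m i       zero    = trans (choose-step m i) (alg (ι m) (choose m i) (choose m (suc i)))
    where
    alg : ∀ a x y → a * x ≡ a * x + 0ℚ * (x + y)
    alg = solve-∀ ℚ-ring
  choose⁻-step m zero (suc zero) = alg (ι m) (choose m 0)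
    where
    alg : ∀ a y → (1ℚ + 0ℚ) * y + 0ℚ * 0ℚ ≡ a * 0ℚ + (1ℚ + 0ℚ) * (0ℚ + y)
    alg = solve-∀ ℚ-ring
  choose⁻-step m zero (suc (suc j)) = alg (ι m) (ι j)
    where
    alg : ∀ a b → (1ℚ + 0ℚ) * 0ℚ + 0ℚ * 0ℚ ≡ a * 0ℚ + (1ℚ + (1ℚ + b)) * (0ℚ + 0ℚ)
    alg = solve-∀ ℚ-ring
  choose⁻-step m (suc i) (suc j) = alg (ι m) (ι i) (ι j) (choose⁻ m i j) (choose⁻ m (suc i) j) (choose⁻-step m i j)
    where
    alg : ∀ a b c x y → (1ℚ + b) * y + b * x ≡ a * x + c * (x + y) →
          (1ℚ + (1ℚ + b)) * y + (1ℚ + b) * x ≡ a * x + (1ℚ + c) * (x + y)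
    alg a b c x y h = lincomb₁ 1ℚ h (solve (a ∷ b ∷ c ∷ x ∷ y ∷ []) ℚ-ring)

  -- The hypergeometric probabilities and the formulas of the statement

  module Hypergeometric (n′ k : ℕ) (1≤k : 1 ℕ.≤ k) (k≤n′ : k ℕ.≤ n′) where

    n : ℕ
    n = suc n′

    -- This proof is the one from which Secretary derives its instance for binomial n k; with another
    -- one, C-nonZero below would be ambiguous.
    k≤n : k ℕ.≤ n
    k≤n = ℕ.<⇒≤ (s≤s k≤n′)

    1/n! : ℚ
    1/n! = _/_ 1ℤ (n !) {{n ℕ.!≢0}}

    1/n!-inverse : 1/n! * ι (n !) ≡ 1ℚ
    1/n!-inverse = /-*-cancel 1ℤ (n !) {{n ℕ.!≢0}}

    0≤1/n! : 0ℚ ≤ 1/n!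
    0≤1/n! = nonNegative⁻¹ 1/n! {{normalize-nonNeg 1 (n !) {{n ℕ.!≢0}}}}

    -- The probability that exactly r of the k best are among the first m candidates.
    q : ℕ → ℕ → ℚ
    q m r = choose k r * choose⁻ (n ∸ k) m r * (ι (m !) * ι ((n ∸ m) !)) * 1/n!

    0≤q : ∀ m r → 0ℚ ≤ q m r
    0≤q m r = 0≤* (0≤* (0≤* (0≤choose k r) (0≤choose⁻ (n ∸ k) m r)) (0≤* (0≤ι (m !)) (0≤ι ((n ∸ m) !)))) 0≤1/n!

    -- If r of the k best are among the first m + 1 candidates, the latest of these candidates is
    -- one of them with probability r / (m + 1). In the formula, `choose-step` accounts for the k
    -- best and `choose⁻-step` for the others.
    q-step : ∀ m r → m ℕ.< n → ι (suc m) * q m r ≡ (ι (suc m) - ι r) * q (suc m) r + ι (suc r) * q (suc m) (suc r)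
    q-step m r m<n =
      alg (ι n) (ι k) (ι m) (ι r) (choose k r) (choose k (suc r)) (choose⁻ (n ∸ k) m r) (choose⁻ (n ∸ k) (suc m) r)
        (ι (n ∸ k)) (ι (m !)) (ι ((n ∸ suc m) !)) (ι ((n ∸ m) !)) (ι (suc m !)) 1/n!
        (choose-step k r) (choose⁻-step (n ∸ k) m r) (ι-∸ k≤n)
        (trans (cong ι (∸-suc-! m<n)) (trans (ι-* (n ∸ m) ((n ∸ suc m) !)) (cong (_* ι ((n ∸ suc m) !)) (ι-∸ (ℕ.<⇒≤ m<n)))))
        (ι-* (suc m) (m !))
      where
      alg : ∀ n k m r c c′ x y M f g g′ f′ v →
        (1ℚ + r) * c′ + r * c ≡ k * c → (1ℚ + m) * y + m * x ≡ M * x + r * (x + y) → M ≡ n - k →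
        g′ ≡ (n - m) * g → f′ ≡ (1ℚ + m) * f →
        (1ℚ + m) * (c * x * (f * g′) * v) ≡
        (1ℚ + m - r) * (c * y * (f′ * g) * v) + (1ℚ + r) * (c′ * x * (f′ * g) * v)
      alg n k m r c c′ x y M f g g′ f′ v h h′ refl refl refl =
        lincomb₂ (- (x * ((1ℚ + m) * f * g * v))) (- (c * ((1ℚ + m) * f * g * v))) h h′
          (solve (n ∷ k ∷ m ∷ r ∷ c ∷ c′ ∷ x ∷ y ∷ f ∷ g ∷ v ∷ []) ℚ-ring)

    q-below : ∀ j → j ℕ.< k → q n j ≡ 0ℚ
    q-below j j<k = trans
      (cong (λ x → choose k j * x * (ι (n !) * ι ((n ∸ n) !)) * 1/n!)
        (trans (choose⁻-∸ (n ∸ k) (ℕ.≤-trans (ℕ.<⇒≤ j<k) k≤n)) (choose-zero (ℕ.∸-monoʳ-< j<k k≤n))))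
      (alg (choose k j) (ι (n !) * ι ((n ∸ n) !)) 1/n!)
      where
      alg : ∀ c f v → c * 0ℚ * f * v ≡ 0ℚ
      alg = solve-∀ ℚ-ring

    q-at : q n k ≡ 1ℚ
    q-at = alg (choose k k) (choose⁻ (n ∸ k) n k) (ι (n !)) (ι ((n ∸ n) !)) 1/n!
      (choose-self k) (trans (choose⁻-∸ (n ∸ k) k≤n) (choose-self (n ∸ k))) (cong (λ m → ι (m !)) (ℕ.n∸n≡0 n)) 1/n!-inverse
      where
      alg : ∀ c x f g v → c ≡ 1ℚ → x ≡ 1ℚ → g ≡ 1ℚ → v * f ≡ 1ℚ → c * x * (f * g) * v ≡ 1ℚ
      alg c x f g v refl refl refl h = lincomb₁ 1ℚ h (solve (f ∷ v ∷ []) ℚ-ring)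

    q-above : ∀ j → k ℕ.< j → q n j ≡ 0ℚ
    q-above j k<j = trans
      (cong (λ c → c * choose⁻ (n ∸ k) n j * (ι (n !) * ι ((n ∸ n) !)) * 1/n!) (choose-zero k<j))
      (alg (choose⁻ (n ∸ k) n j) (ι (n !) * ι ((n ∸ n) !)) 1/n!)
      where
      alg : ∀ x f v → 0ℚ * x * f * v ≡ 0ℚ
      alg = solve-∀ ℚ-ring

    open Chain n′ k q q-step 0≤q public

    C : ℚ
    C = choose n k

    instance
      C-nonZero : ℚ.NonZero C
      C-nonZero = binomial-nonZero k≤n

    -- This and the next identity come from factoring falling n (k + m) both as
    -- falling n k * falling (n ∸ k) m and as falling n m * falling (n ∸ m) k.
    choose-÷-C : ∀ m → m ℕ.≤ n → choose (n ∸ m) k * 1/ C ≡ q m 0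
    choose-÷-C m m≤n = *-cancelʳ C (*-cancelʳ (ι (n !)) {{ !-nonZero n }} (*-cancelʳ (ι (k !)) {{ !-nonZero k }} (*-cancelʳ (ι (m !)) {{ !-nonZero m }}
      (alg (choose (n ∸ m) k) C (1/ C) (ι (n !)) 1/n! (ι (k !)) (ι (m !)) (ι ((n ∸ m) !)) (choose k 0) (choose (n ∸ k) m)
        (falling (n ∸ m) k) (falling n k) (falling (n ∸ k) m) (falling n m)
        (choose-! (n ∸ m) k) (choose-! n k) (choose-! (n ∸ k) m)
        (trans (sym (falling-+ m k≤n)) (trans (cong (falling n) (ℕ.+-comm m k)) (falling-+ k m≤n)))
        (falling-! m m≤n) (*-inverseˡ C) 1/n!-inverse refl))))
      where
      alg : ∀ a C w N v K m M c₀ b a′ C′ b′ m′ → a * K ≡ a′ → C * K ≡ C′ → b * m ≡ b′ → C′ * b′ ≡ m′ * a′ →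
        m′ * M ≡ N → w * C ≡ 1ℚ → v * N ≡ 1ℚ → c₀ ≡ 1ℚ →
        a * w * C * N * K * m ≡ c₀ * b * (m * M) * v * C * N * K * m
      alg a C w N v K m M c₀ b a′ C′ b′ m′ refl refl refl h refl hw hv refl =
        lincomb₃ (a * (m′ * M) * K * m) (- (b * m * M * C * K * m)) (- (M * m)) hw hv h
          (solve (a ∷ C ∷ w ∷ v ∷ K ∷ m ∷ M ∷ b ∷ m′ ∷ []) ℚ-ring)

    choose-÷-C-pred : ∀ k⁻ m → k ≡ suc k⁻ → suc m ℕ.≤ n → choose (n ∸ suc m) k⁻ * 1/ C ≡ q (suc m) 1 * inv m
    choose-÷-C-pred k⁻ m refl m<n = *-cancelʳ C (*-cancelʳ (ι (n !)) {{ !-nonZero n }} (*-cancelʳ (ι (k⁻ !)) {{ !-nonZero k⁻ }}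
      (alg (choose (n ∸ suc m) k⁻) C (1/ C) (ι (n !)) 1/n! (ι k) (ι (k⁻ !)) (ι (k !)) (ι (suc m)) (inv m)
        (ι (m !)) (ι (suc m !)) (ι ((n ∸ suc m) !)) (choose k 1) (choose (n ∸ k) m)
        (falling (n ∸ suc m) k⁻) (falling n k) (falling (n ∸ k) m) (falling n (suc m))
        (choose-! (n ∸ suc m) k⁻) (choose-! n k) (choose-! (n ∸ k) m) (ι-* k (k⁻ !)) (ι-* (suc m) (m !))
        (trans (sym (falling-+ m k≤n)) (trans (cong (falling n) (m+k≡ m k⁻)) (falling-+ k⁻ m<n)))
        (falling-! (suc m) m<n) (*-inverseˡ C) 1/n!-inverse (inv-inverse m) (choose-one k))))
      where
      m+k≡ : ∀ a b → a ℕ.+ suc b ≡ b ℕ.+ suc a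
      m+k≡ a b = trans (ℕ.+-suc a b) (trans (cong suc (ℕ.+-comm a b)) (sym (ℕ.+-suc b a)))
      alg : ∀ a C w N v k K⁻ K μ i f g M c₁ b a′ C′ b′ m′ → a * K⁻ ≡ a′ → C * K ≡ C′ → b * f ≡ b′ →
        K ≡ k * K⁻ → g ≡ μ * f → C′ * b′ ≡ m′ * a′ →
        m′ * M ≡ N → w * C ≡ 1ℚ → v * N ≡ 1ℚ → i * μ ≡ 1ℚ → c₁ ≡ k →
        a * w * C * N * K⁻ ≡ c₁ * b * (g * M) * v * i * C * N * K⁻
      alg a C w N v k K⁻ K μ i f g M c₁ b a′ C′ b′ m′ refl refl refl refl refl h refl hw hv hi refl =
        lincomb₄ (a * (m′ * M) * K⁻) (- (k * b * μ * f * M * i * C * K⁻)) (- (k * b * f * M * C * K⁻)) (- M) hw hv hi h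
          (solve (a ∷ C ∷ w ∷ v ∷ k ∷ K⁻ ∷ μ ∷ i ∷ f ∷ M ∷ b ∷ m′ ∷ []) ℚ-ring)

    open Secretary n k (s≤s k≤n′)

    innerSum-÷-C : ∀ x → suc x ℕ.≤ n → (1ℚ ÷ C) * innerSum x ≡ J x
    innerSum-÷-C zero    _   = *-zeroʳ (1ℚ ÷ C)
    innerSum-÷-C (suc x) x<n = begin
      (1ℚ ÷ C) * innerSum (suc x)
        ≡⟨ cong ((1ℚ ÷ C) *_) (∑-snoc x (λ i → binomial (+ n ℤ.- + suc i ℤ.- 1ℤ) (+ k ℤ.- 1ℤ) * inv i)) ⟩
      (1ℚ ÷ C) * (innerSum x + binomial (+ n ℤ.- + suc x ℤ.- 1ℤ) (+ k ℤ.- 1ℤ) * inv x)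
        ≡⟨ cong₂ (λ a b → (1ℚ ÷ C) * (innerSum x + binomial a b * inv x)) (sub₂ x<n) (sub 1≤k) ⟩
      (1ℚ ÷ C) * (innerSum x + choose (n ∸ suc (suc x)) (k ∸ 1) * inv x)
        ≡⟨ alg (1/ C) (innerSum x) (choose (n ∸ suc (suc x)) (k ∸ 1)) (inv x) (J x) (q (2 ℕ.+ x) 1) (inv (suc x))
               (innerSum-÷-C x (ℕ.<⇒≤ x<n)) (choose-÷-C-pred (k ∸ 1) (suc x) (sym (ℕ.m+[n∸m]≡n 1≤k)) x<n) ⟩
      J (suc x) ∎
      where
      open ≡-Reasoning
      alg : ∀ w s c i j p i′ → (1ℚ * w) * s ≡ j → c * w ≡ p * i′ → (1ℚ * w) * (s + c * i) ≡ j + p * (i′ * i)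
      alg w s c i j p i′ h h′ = lincomb₂ 1ℚ i h h′ (solve (w ∷ s ∷ c ∷ i ∷ j ∷ p ∷ i′ ∷ []) ℚ-ring)

    /n : ∀ i → + i / n ≡ ι i * inv n′
    /n i = *-cancelʳ-ι n (trans (/-*-cancel (+ i) n) (trans (sym (ι≡/1 i)) (alg (ι i) (inv n′) (ι n) (inv-inverse n′))))
      where
      alg : ∀ a v b → v * b ≡ 1ℚ → a ≡ a * v * b
      alg a v b h = lincomb₁ (- a) h (solve (a ∷ v ∷ b ∷ []) ℚ-ring)

    E-∑ : ∀ m r → E m (suc r) ≡ ∑[ j < r ] (ι (suc (toℕ j)) * q m (suc (toℕ j)))
    E-∑ m zero    = trans (+-identityˡ _) (*-zeroˡ (q m 0))
    E-∑ m (suc r) = trans (cong (_+ ι (suc r) * q m (suc r)) (E-∑ m r)) (sym (∑-snoc r (λ j → ι (suc j) * q m (suc j))))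

    -- For l ≥ 2 the sum in `d` is the truncated first moment `E` with r = j + 1: absorption turns k
    -- times the binomial of k - 1 over j into r times that of k over r, and `rise⁻¹` reduces (l +
    -- x)! to x!. For l < 2 the translation is given by `choose-÷-C` and `innerSum-÷-C`.
    d≡dq : ∀ l x → l ℕ.+ x ℕ.≤ n → suc x ℕ.≤ n → d l x ≡ dq l x
    d≡dq 0 x _ x<n = begin
      - 1ℚ + (+ (k ℕ.* x) / n) + binomial (+ n ℤ.- + x ℤ.- 1ℤ) (+ k) ÷ C + ((+ x / 1) ÷ C) * innerSum x
        ≡⟨ cong (λ b → - 1ℚ + (+ (k ℕ.* x) / n) + binomial b (+ k) ÷ C + ((+ x / 1) ÷ C) * innerSum x) (sub₂ x<n) ⟩
      - 1ℚ + (+ (k ℕ.* x) / n) + choose (n ∸ suc x) k ÷ C + ((+ x / 1) ÷ C) * innerSum x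
        ≡⟨ alg (+ (k ℕ.* x) / n) (ι k * ι x * inv n′) (choose (n ∸ suc x) k ÷ C) (q (suc x) 0) (+ x / 1) (ι x) (1/ C) (innerSum x) (J x)
               (trans (/n (k ℕ.* x)) (cong (_* inv n′) (ι-* k x))) (choose-÷-C (suc x) x<n) (sym (ι≡/1 x)) (innerSum-÷-C x x<n) ⟩
      dq 0 x ∎
      where
      open ≡-Reasoning
      alg : ∀ a a′ b b′ c c′ w s j → a ≡ a′ → b ≡ b′ → c ≡ c′ → (1ℚ * w) * s ≡ j → - 1ℚ + a + b + (c * w) * s ≡ - 1ℚ + a′ + b′ + c′ * j
      alg a a′ b b′ c c′ w s j refl refl refl refl = solve (a ∷ b ∷ c ∷ w ∷ s ∷ []) ℚ-ring
    d≡dq 1 x _ x<n = cong₂ (λ a b → - a - b) (/n k) (innerSum-÷-C x x<n)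
    d≡dq (suc (suc l)) x L+x≤n _ = begin
      z * ∑[ j < suc l ] (binomial (+ k ℤ.- 1ℤ) (+ toℕ j) * binomial (+ n ℤ.- + k) (+ x ℤ.+ + L ℤ.- + toℕ j ℤ.- 1ℤ))
        ≡⟨ *-distribˡ-sum z (λ (j : Fin (suc l)) → binomial (+ k ℤ.- 1ℤ) (+ toℕ j) * binomial (+ n ℤ.- + k) (+ x ℤ.+ + L ℤ.- + toℕ j ℤ.- 1ℤ)) ⟩
      ∑[ j < suc l ] (z * (binomial (+ k ℤ.- 1ℤ) (+ toℕ j) * binomial (+ n ℤ.- + k) (+ x ℤ.+ + L ℤ.- + toℕ j ℤ.- 1ℤ)))
        ≡⟨ sum-cong-≗ (λ (j : Fin (suc l)) → term (toℕ j) (ℕ.≤-pred (toℕ<n j))) ⟩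
      ∑[ j < suc l ] (c * (ι (suc (toℕ j)) * q (L ℕ.+ x) (suc (toℕ j))))
        ≡⟨ *-distribˡ-sum c (λ (j : Fin (suc l)) → ι (suc (toℕ j)) * q (L ℕ.+ x) (suc (toℕ j))) ⟨
      c * ∑[ j < suc l ] (ι (suc (toℕ j)) * q (L ℕ.+ x) (suc (toℕ j)))
        ≡⟨ cong (c *_) (E-∑ (L ℕ.+ x) (suc l)) ⟨
      c * E (L ℕ.+ x) L
        ≡⟨ alg (inv (suc l)) (inv l) (rise⁻¹ x L) (E (L ℕ.+ x) L) ⟩
      dq L x ∎
      where
      open ≡-Reasoning
      L : ℕ
      L = suc (suc l)
      z c : ℚ
      z = _/_ (+ (k ℕ.* x ! ℕ.* (n ∸ L ∸ x) !)) (L ℕ.* (L ∸ 1) ℕ.* n !) {{ℕ.m*n≢0 (L ℕ.* (L ∸ 1)) (n !) {{_}} {{n ℕ.!≢0}}}}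
      c = (inv (suc l) * inv l) * rise⁻¹ x L
      alg : ∀ a b r e → ((a * b) * r) * e ≡ e * (a * b) * r
      alg = solve-∀ ℚ-ring
      z≡ : z ≡ ι k * ι (x !) * ι ((n ∸ (L ℕ.+ x)) !) * (inv (suc l) * inv l) * 1/n!
      z≡ = *-cancelʳ-ι (L ℕ.* suc l ℕ.* n !) {{ℕ.m*n≢0 (L ℕ.* suc l) (n !) {{_}} {{n ℕ.!≢0}}}} (begin
        z * ι (L ℕ.* suc l ℕ.* n !)
          ≡⟨ /-*-cancel (+ (k ℕ.* x ! ℕ.* (n ∸ L ∸ x) !)) (L ℕ.* suc l ℕ.* n !) {{ℕ.m*n≢0 (L ℕ.* suc l) (n !) {{_}} {{n ℕ.!≢0}}}} ⟩
        ℤ→ℚ (+ (k ℕ.* x ! ℕ.* (n ∸ L ∸ x) !))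
          ≡⟨ ι≡/1 (k ℕ.* x ! ℕ.* (n ∸ L ∸ x) !) ⟨
        ι (k ℕ.* x ! ℕ.* (n ∸ L ∸ x) !)
          ≡⟨ trans (ι-* (k ℕ.* x !) ((n ∸ L ∸ x) !)) (cong₂ _*_ (ι-* k (x !)) (cong (λ m → ι (m !)) (ℕ.∸-+-assoc n L x))) ⟩
        ι k * ι (x !) * ι ((n ∸ (L ℕ.+ x)) !)
          ≡⟨ alg₁ (ι k * ι (x !) * ι ((n ∸ (L ℕ.+ x)) !)) (ι L) (ι (suc l)) (ι (n !)) (inv (suc l)) (inv l) 1/n!
               (inv-inverse (suc l)) (inv-inverse l) 1/n!-inverse ⟩
        ι k * ι (x !) * ι ((n ∸ (L ℕ.+ x)) !) * (inv (suc l) * inv l) * 1/n! * (ι L * ι (suc l) * ι (n !))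
          ≡⟨ cong (ι k * ι (x !) * ι ((n ∸ (L ℕ.+ x)) !) * (inv (suc l) * inv l) * 1/n! *_)
               (sym (trans (ι-* (L ℕ.* suc l) (n !)) (cong (_* ι (n !)) (ι-* L (suc l))))) ⟩
        ι k * ι (x !) * ι ((n ∸ (L ℕ.+ x)) !) * (inv (suc l) * inv l) * 1/n! * ι (L ℕ.* suc l ℕ.* n !) ∎)
        where
        alg₁ : ∀ a b b′ N i i′ v → i * b ≡ 1ℚ → i′ * b′ ≡ 1ℚ → v * N ≡ 1ℚ → a ≡ a * (i * i′) * v * (b * b′ * N)
        alg₁ a b b′ N i i′ v h h′ hv = lincomb₃ (- a) (- (a * i * b)) (- (a * i * b * i′ * b′)) h h′ hv
          (solve (a ∷ b ∷ b′ ∷ N ∷ i ∷ i′ ∷ v ∷ []) ℚ-ring)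
      rise-! : ∀ l → rise⁻¹ x l * ι ((l ℕ.+ x) !) ≡ ι (x !)
      rise-! zero    = *-identityˡ (ι (x !))
      rise-! (suc l) = alg₂ (rise⁻¹ x l) (inv (l ℕ.+ x)) (ι (suc (l ℕ.+ x))) (ι ((l ℕ.+ x) !)) (ι ((suc l ℕ.+ x) !)) (ι (x !))
        (inv-inverse (l ℕ.+ x)) (ι-* (suc (l ℕ.+ x)) ((l ℕ.+ x) !)) (rise-! l)
        where
        alg₂ : ∀ r i a f g h → i * a ≡ 1ℚ → g ≡ a * f → r * f ≡ h → (r * i) * g ≡ h
        alg₂ r i a f g h hi refl refl = lincomb₁ (r * f) hi (solve (r ∷ i ∷ a ∷ f ∷ []) ℚ-ring)
      term : ∀ j → j ℕ.≤ l →
        z * (binomial (+ k ℤ.- 1ℤ) (+ j) * binomial (+ n ℤ.- + k) (+ x ℤ.+ + L ℤ.- + j ℤ.- 1ℤ))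
        ≡ c * (ι (suc j) * q (L ℕ.+ x) (suc j))
      term j j≤l = begin
        z * (binomial (+ k ℤ.- 1ℤ) (+ j) * binomial (+ n ℤ.- + k) (+ x ℤ.+ + L ℤ.- + j ℤ.- 1ℤ))
          ≡⟨ cong₂ (λ a b → z * (binomial a (+ j) * b)) (sub 1≤k) (cong₂ binomial (sub k≤n) (sub₂ j<x+L)) ⟩
        z * (choose (k ∸ 1) j * choose (n ∸ k) (x ℕ.+ L ∸ suc j))
          ≡⟨ alg₃ (choose (k ∸ 1) j) (choose k (suc j)) (choose (n ∸ k) (x ℕ.+ L ∸ suc j)) (choose⁻ (n ∸ k) (L ℕ.+ x) (suc j))
               z (ι k) (ι (suc j)) (inv (suc l) * inv l) (rise⁻¹ x L) (ι ((L ℕ.+ x) !)) (ι (x !)) (ι ((n ∸ (L ℕ.+ x)) !)) 1/n!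
               z≡ (absorb k 1≤k) (trans (cong (λ m → choose (n ∸ k) (m ∸ suc j)) (ℕ.+-comm x L)) (sym (choose⁻-∸ (n ∸ k) (subst (suc j ℕ.≤_) (ℕ.+-comm x L) j<x+L))))
               (rise-! L) ⟩
        c * (ι (suc j) * q (L ℕ.+ x) (suc j)) ∎
        where
        j<x+L : suc j ℕ.≤ x ℕ.+ L
        j<x+L = ℕ.≤-trans (s≤s (ℕ.m≤n⇒m≤1+n j≤l)) (ℕ.m≤n+m L x)
        absorb : ∀ k → 1 ℕ.≤ k → ι k * choose (k ∸ 1) j ≡ ι (suc j) * choose k (suc j)
        absorb (suc k⁻) _ = choose-absorb k⁻ j
        alg₃ : ∀ a a′ b b′ z k j i r f g h v → z ≡ k * g * h * i * v → k * a ≡ j * a′ → b ≡ b′ → r * f ≡ g →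
               z * (a * b) ≡ i * r * (j * (a′ * b′ * (f * h) * v))
        alg₃ a a′ b b′ z k j i r f g h v refl ha refl refl = lincomb₁ (r * f * h * i * v * b) ha
          (solve (a ∷ a′ ∷ b ∷ k ∷ j ∷ i ∷ r ∷ f ∷ h ∷ v ∷ []) ℚ-ring)

    -- For k = 1 the binomials in `innerSum` have lower index 0, so they equal 1, and `C` is n.
    δ-one : k ≡ 1 → δ k n ≡ - J n′
    δ-one refl = cong -_ (begin
      inv n′ * ∑[ j < n′ ] inv (toℕ j)
        ≡⟨ cong₂ _*_ 1/C≡ (sum-cong-≗ {n′} (λ j → *-identityˡ (inv (toℕ j)))) ⟨
      (1ℚ ÷ C) * innerSum n′
        ≡⟨ innerSum-÷-C n′ ℕ.≤-refl ⟩
      J n′ ∎)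
      where
      open ≡-Reasoning
      1/C≡ : 1ℚ ÷ C ≡ inv n′
      1/C≡ = *-cancelʳ C (trans (alg (1/ C) C (*-inverseˡ C)) (sym (trans (cong (inv n′ *_) (choose-one n)) (inv-inverse n′))))
        where
        alg : ∀ w c → w * c ≡ 1ℚ → 1ℚ * w * c ≡ 1ℚ
        alg w c h = lincomb₁ 1ℚ h (solve (w ∷ c ∷ []) ℚ-ring)

    private
      δ-two : ∀ k → 2 ℕ.≤ k → δ k n ≡ _/_ (+ ((n ∸ k) !)) (n !) {{n ℕ.!≢0}}
      δ-two (suc (suc _)) (s≤s (s≤s _)) = refl

    0≤δ : 2 ℕ.≤ k → 0ℚ ≤ δ k n
    0≤δ 2≤k = subst (0ℚ ≤_) (sym (δ-two k 2≤k))
      (nonNegative⁻¹ _ {{normalize-nonNeg ((n ∸ k) !) (n !) {{n ℕ.!≢0}}}})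

    δ-rise : 2 ℕ.≤ k → δ k n * rise (n′ ∸ k) k ≡ 1ℚ - ι k * inv n′
    δ-rise 2≤k = *-cancelʳ (ι (n !)) {{ !-nonZero n }}
      (alg (δ k n) (ι n′) (ι k) (ι (n′ !)) (ι ((n′ ∸ k) !)) (ι ((n ∸ k) !)) (ι (n !)) (inv n′) (rise (n′ ∸ k) k) (ι (n′ ∸ k))
        (trans (cong (_* ι (n !)) (δ-two k 2≤k)) (trans (/-*-cancel (+ ((n ∸ k) !)) (n !) {{n ℕ.!≢0}}) (sym (ι≡/1 ((n ∸ k) !)))))
        (ι-* n (n′ !)) (trans (cong (λ m → ι (m !)) (ℕ.+-∸-assoc 1 k≤n′)) (ι-* (suc (n′ ∸ k)) ((n′ ∸ k) !)))
        (trans (rise-! (n′ ∸ k) k) (cong (λ m → ι (m !)) (ℕ.m+[n∸m]≡n k≤n′))) (ι-∸ k≤n′) (inv-inverse n′))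
      where
      rise-! : ∀ x l → rise x l * ι (x !) ≡ ι ((l ℕ.+ x) !)
      rise-! x zero    = *-identityˡ (ι (x !))
      rise-! x (suc l) = trans (alg (rise x l) (ι (suc (l ℕ.+ x))) (ι (x !)) (ι ((l ℕ.+ x) !)) (rise-! x l)) (sym (ι-* (suc (l ℕ.+ x)) ((l ℕ.+ x) !)))
        where
        alg : ∀ r a f g → r * f ≡ g → r * a * f ≡ a * g
        alg r a f g refl = solve (r ∷ a ∷ f ∷ []) ℚ-ring
      alg : ∀ d a c b g G N v r s → d * N ≡ G → N ≡ (1ℚ + a) * b → G ≡ (1ℚ + s) * g → r * g ≡ b → s ≡ a - c →
            v * (1ℚ + a) ≡ 1ℚ → (d * r) * N ≡ (1ℚ - c * v) * N
      alg d a c b g G N v r s h refl refl refl refl hv = lincomb₂ r (c * (r * g)) h hv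
        (solve (d ∷ a ∷ c ∷ g ∷ v ∷ r ∷ []) ℚ-ring)

    open Boundary 1≤k k≤n′ q-below q-at q-above (δ k n) δ-one 0≤δ δ-rise public

  -- Insertion of a last candidate into an ordering

  𝟙 : Bool → ℕ
  𝟙 b = if b then 1 else 0

  punchIn-fromℕ : ∀ {m} (i : Fin m) → punchIn (fromℕ m) i ≡ inject₁ i
  punchIn-fromℕ zero    = refl
  punchIn-fromℕ (suc i) = cong suc (punchIn-fromℕ i)

  insert-inject₁ : ∀ {m} (j : Fin (suc m)) (π : Permutation′ m) i →
                   insert (fromℕ m) j π ⟨$⟩ʳ inject₁ i ≡ punchIn j (π ⟨$⟩ʳ i)
  insert-inject₁ {m} j π i = trans (cong (insert (fromℕ m) j π ⟨$⟩ʳ_) (sym (punchIn-fromℕ i))) (insert-punchIn (fromℕ m) j π i)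

  insert-fromℕ : ∀ {m} (j : Fin (suc m)) (π : Permutation′ m) → insert (fromℕ m) j π ⟨$⟩ʳ fromℕ m ≡ j
  insert-fromℕ {m} j π with fromℕ m Fin.≟ fromℕ m
  ... | yes _   = refl
  ... | no  m≢m = contradiction refl m≢m

  module _ {A : Set} {P : Pred A 0ℓ} (P? : Decidable P) where

    length-filter-tabulate : ∀ {m} (f : Fin m → A) → length (filter P? (tabulate f)) ≡ sumℕ (λ i → 𝟙 (does (P? (f i))))
    length-filter-tabulate {zero}  f = refl
    length-filter-tabulate {suc m} f with does (P? (f zero))
    ... | true  = cong suc (length-filter-tabulate (f ∘ suc))
    ... | false = length-filter-tabulate (f ∘ suc)

    -- `find` works from the front, whereas orderings grow at the end; this splits off the newcomer.
    find-tabulate-snoc : ∀ {m} (f : Fin (suc m) → A) → find P? (tabulate f) ≡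
      find P? (tabulate (f ∘ inject₁)) <∣> (if does (P? (f (fromℕ m))) then just (f (fromℕ m)) else nothing)
    find-tabulate-snoc {zero}  f = refl
    find-tabulate-snoc {suc m} f with does (P? (f zero))
    ... | true  = refl
    ... | false = find-tabulate-snoc (f ∘ suc)

    find-tabulate-map : ∀ {B : Set} {Q : Pred B 0ℓ} (Q? : Decidable Q) (g : A → B) →
      (∀ x → does (Q? (g x)) ≡ does (P? x)) →
      ∀ {m} (f : Fin m → A) → find Q? (tabulate (g ∘ f)) ≡ Maybe.map g (find P? (tabulate f))
    find-tabulate-map Q? g eq {zero}  f = refl
    find-tabulate-map Q? g eq {suc m} f rewrite eq (f zero) with does (P? (f zero))
    ... | true  = refl
    ... | false = find-tabulate-map Q? g eq (f ∘ suc)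

  inject₁-mono-≤ : ∀ {m} {i j : Fin m} → i Fin.≤ j → inject₁ i Fin.≤ inject₁ j
  inject₁-mono-≤ {i = i} {j} = subst₂ ℕ._≤_ (sym (toℕ-inject₁ i)) (sym (toℕ-inject₁ j))

  inject₁-cancel-≤ : ∀ {m} {i j : Fin m} → inject₁ i Fin.≤ inject₁ j → i Fin.≤ j
  inject₁-cancel-≤ {i = i} {j} = subst₂ ℕ._≤_ (toℕ-inject₁ i) (toℕ-inject₁ j)

  fromℕ≰inject₁ : ∀ {m} (i : Fin m) → fromℕ m Fin.≤ inject₁ i → ∀ {A : Set} → A
  fromℕ≰inject₁ i le = contradiction (subst₂ ℕ._≤_ (toℕ-fromℕ _) (toℕ-inject₁ i) le) (ℕ.<⇒≱ (toℕ<n i))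

  ranksUpTo : ∀ {m} → Permutation′ m → Fin m → Pred (Fin m) 0ℓ
  ranksUpTo π i j = j Fin.≤ i × (π ⟨$⟩ʳ j) Fin.≤ (π ⟨$⟩ʳ i)

  ranksUpTo? : ∀ {m} (π : Permutation′ m) i → Decidable (ranksUpTo π i)
  ranksUpTo? π i j = (j Fin.≤? i) ×-dec ((π ⟨$⟩ʳ j) Fin.≤? (π ⟨$⟩ʳ i))

  relativeRank-∑ : ∀ {m} (π : Permutation′ m) i → relativeRank π i ≡ sumℕ {m} (λ j → 𝟙 (does (ranksUpTo? π i j)))
  relativeRank-∑ {m} π i = length-filter-tabulate (ranksUpTo? π i) {m} (λ j → j)

  -- `punchIn j` preserves the order of the old ranks, and the newcomer arrives too late to be
  -- counted.
  relativeRank-inject₁ : ∀ {m} (j : Fin (suc m)) (π : Permutation′ m) i →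
                         relativeRank (insert (fromℕ m) j π) (inject₁ i) ≡ relativeRank π i
  relativeRank-inject₁ {m} j π i = begin
    relativeRank π′ (inject₁ i)
      ≡⟨ relativeRank-∑ π′ (inject₁ i) ⟩
    sumℕ ind′
      ≡⟨ sumℕ-init-last ind′ ⟩
    sumℕ (ind′ ∘ inject₁) ℕ.+ ind′ (fromℕ m)
      ≡⟨ cong₂ ℕ._+_ (sumℕ-cong {m} (λ l → cong 𝟙 (does-⇔ (mk⇔ (to l) (from l)) (ranksUpTo? π′ (inject₁ i) (inject₁ l)) (ranksUpTo? π i l))))
                     (cong 𝟙 (dec-false (ranksUpTo? π′ (inject₁ i) (fromℕ m)) (λ le → fromℕ≰inject₁ i (proj₁ le)))) ⟩
    sumℕ {m} (λ l → 𝟙 (does (ranksUpTo? π i l))) ℕ.+ 0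
      ≡⟨ ℕ.+-identityʳ (sumℕ {m} (λ l → 𝟙 (does (ranksUpTo? π i l)))) ⟩
    sumℕ {m} (λ l → 𝟙 (does (ranksUpTo? π i l)))
      ≡⟨ relativeRank-∑ π i ⟨
    relativeRank π i ∎
    where
    open ≡-Reasoning
    π′ : Permutation′ (suc m)
    π′ = insert (fromℕ m) j π
    ind′ : Fin (suc m) → ℕ
    ind′ l = 𝟙 (does (ranksUpTo? π′ (inject₁ i) l))
    to : ∀ l → ranksUpTo π′ (inject₁ i) (inject₁ l) → ranksUpTo π i l
    to l (le , le′) = inject₁-cancel-≤ le ,
      punchIn-cancel-≤ j _ _ (subst₂ Fin._≤_ (insert-inject₁ j π l) (insert-inject₁ j π i) le′)
    from : ∀ l → ranksUpTo π i l → ranksUpTo π′ (inject₁ i) (inject₁ l)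
    from l (le , le′) = inject₁-mono-≤ le ,
      subst₂ Fin._≤_ (sym (insert-inject₁ j π l)) (sym (insert-inject₁ j π i)) (punchIn-mono-≤ j _ _ le′)

  sumℕ-≤ : ∀ {m} (j : Fin m) → sumℕ {m} (λ i → 𝟙 (does (i Fin.≤? j))) ≡ suc (toℕ j)
  sumℕ-≤ {suc m} zero    = cong suc (sumℕ-zero m)
  sumℕ-≤ {suc m} (suc j) = cong suc (trans
    (sumℕ-cong {m} (λ i → cong 𝟙 (does-⇔ (mk⇔ ℕ.≤-pred s≤s) (suc i Fin.≤? suc j) (i Fin.≤? j)))) (sumℕ-≤ j))

  -- All candidates have arrived, so only ranks are compared; reindexing the count by the
  -- permutation makes it a count of the ranks up to j. Hence the newcomer's relative rank runs once
  -- through 1, ..., m + 1.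
  relativeRank-fromℕ : ∀ {m} (j : Fin (suc m)) (π : Permutation′ m) →
                       relativeRank (insert (fromℕ m) j π) (fromℕ m) ≡ suc (toℕ j)
  relativeRank-fromℕ {m} j π = begin
    relativeRank π′ (fromℕ m)
      ≡⟨ relativeRank-∑ π′ (fromℕ m) ⟩
    sumℕ {suc m} (λ l → 𝟙 (does (ranksUpTo? π′ (fromℕ m) l)))
      ≡⟨ sumℕ-cong {suc m} (λ l → cong 𝟙 (does-⇔ (mk⇔
           (λ le → subst ((π′ ⟨$⟩ʳ l) Fin.≤_) (insert-fromℕ j π) (proj₂ le))
           (λ le → ≤fromℕ l , subst ((π′ ⟨$⟩ʳ l) Fin.≤_) (sym (insert-fromℕ j π)) le))
           (ranksUpTo? π′ (fromℕ m) l) ((π′ ⟨$⟩ʳ l) Fin.≤? j))) ⟩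
    sumℕ {suc m} (λ l → 𝟙 (does ((π′ ⟨$⟩ʳ l) Fin.≤? j)))
      ≡⟨ sumℕ-permute {suc m} {suc m} (λ l → 𝟙 (does (l Fin.≤? j))) π′ ⟨
    sumℕ {suc m} (λ l → 𝟙 (does (l Fin.≤? j)))
      ≡⟨ sumℕ-≤ j ⟩
    suc (toℕ j) ∎
    where
    open ≡-Reasoning
    π′ : Permutation′ (suc m)
    π′ = insert (fromℕ m) j π

  -- Sums over all orderings

  ∑ₗ : {A : Set} → (A → ℚ) → List A → ℚ
  ∑ₗ f []       = 0ℚ
  ∑ₗ f (x ∷ xs) = f x + ∑ₗ f xs

  ∑ₗ-cong : ∀ {A : Set} {f g : A → ℚ} → (∀ x → f x ≡ g x) → ∀ xs → ∑ₗ f xs ≡ ∑ₗ g xs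
  ∑ₗ-cong eq []       = refl
  ∑ₗ-cong eq (x ∷ xs) = cong₂ _+_ (eq x) (∑ₗ-cong eq xs)

  ∑ₗ-++ : ∀ {A : Set} (f : A → ℚ) xs ys → ∑ₗ f (xs ++ ys) ≡ ∑ₗ f xs + ∑ₗ f ys
  ∑ₗ-++ f []       ys = sym (+-identityˡ _)
  ∑ₗ-++ f (x ∷ xs) ys = trans (cong (λ p → f x + p) (∑ₗ-++ f xs ys)) (sym (+-assoc (f x) _ _))

  ∑ₗ-map : ∀ {A B : Set} (f : B → ℚ) (g : A → B) xs → ∑ₗ f (map g xs) ≡ ∑ₗ (f ∘ g) xs
  ∑ₗ-map f g []       = refl
  ∑ₗ-map f g (x ∷ xs) = cong (λ p → f (g x) + p) (∑ₗ-map f g xs)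

  ∑ₗ-* : ∀ {A : Set} c (f : A → ℚ) xs → ∑ₗ (λ x → c * f x) xs ≡ c * ∑ₗ f xs
  ∑ₗ-* c f []       = sym (*-zeroʳ c)
  ∑ₗ-* c f (x ∷ xs) = trans (cong (λ p → c * f x + p) (∑ₗ-* c f xs)) (sym (*-distribˡ-+ c (f x) (∑ₗ f xs)))

  ∑ₗ-∑ : ∀ {A : Set} m (f : Fin m → A → ℚ) xs → ∑ₗ (λ x → ∑[ j < m ] f j x) xs ≡ ∑[ j < m ] ∑ₗ (f j) xs
  ∑ₗ-∑ m f []       = sym (sum-replicate-zero m)
  ∑ₗ-∑ m f (x ∷ xs) = trans (cong (λ p → ∑[ j < m ] f j x + p) (∑ₗ-∑ m f xs)) (sym (∑-distrib-+ (λ j → f j x) (λ j → ∑ₗ (f j) xs)))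

  ∑ₗ-cartesianProductWith : ∀ {A B C : Set} (f : C → ℚ) (g : A → B → C) {m} (h : Fin m → A) ys →
    ∑ₗ f (cartesianProductWith g (tabulate h) ys) ≡ ∑[ j < m ] ∑ₗ (f ∘ g (h j)) ys
  ∑ₗ-cartesianProductWith f g {zero}  h ys = refl
  ∑ₗ-cartesianProductWith f g {suc m} h ys = trans (∑ₗ-++ f (map (g (h zero)) ys) (cartesianProductWith g (tabulate (h ∘ suc)) ys))
    (cong₂ _+_ (∑ₗ-map f (g (h zero)) ys) (∑ₗ-cartesianProductWith f g (h ∘ suc) ys))

  length-filter-∑ₗ : ∀ {A : Set} {P : Pred A 0ℓ} (P? : Decidable P) xs → ι (length (filter P? xs)) ≡ ∑ₗ (λ x → ι (𝟙 (does (P? x)))) xs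
  length-filter-∑ₗ P? []       = refl
  length-filter-∑ₗ P? (x ∷ xs) with does (P? x)
  ... | true  = cong (λ p → 1ℚ + p) (length-filter-∑ₗ P? xs)
  ... | false = trans (length-filter-∑ₗ P? xs) (sym (+-identityˡ _))

  -- The sums are exchanged so that the inner one is, up to the factor m + 1, a conditional
  -- expectation given the relative order of the first m candidates.
  ∑ₗ-orderings : ∀ m (f : Permutation′ (suc m) → ℚ) →
    ∑ₗ f (orderings (suc m)) ≡ ∑ₗ (λ π → ∑[ j < suc m ] f (insert (fromℕ m) j π)) (orderings m)
  ∑ₗ-orderings m f = trans (∑ₗ-cartesianProductWith f (insert (fromℕ m)) (λ j → j) (orderings m))
    (sym (∑ₗ-∑ (suc m) (λ j π → f (insert (fromℕ m) j π)) (orderings m)))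

  ∑-if : ∀ {N l} (f : ℕ → ℚ) b → l ℕ.≤ N →
    ∑[ j < N ] (if does (toℕ j ℕ.<? l) then f (toℕ j) else b) ≡ ∑[ j < l ] f (toℕ j) + (ι N - ι l) * b
  ∑-if {zero}          f b z≤n = alg b
    where
    alg : ∀ b → 0ℚ ≡ 0ℚ + (0ℚ - 0ℚ) * b
    alg = solve-∀ ℚ-ring
  ∑-if {suc N} {zero}  f b z≤n = trans (cong (λ p → b + p) (∑-if {N} {zero} f b z≤n)) (alg (ι N) b)
    where
    alg : ∀ n b → b + (0ℚ + (n - 0ℚ) * b) ≡ 0ℚ + (1ℚ + n - 0ℚ) * b
    alg = solve-∀ ℚ-ring
  ∑-if {suc N} {suc l} f b (s≤s l≤N) = trans
    (cong (λ p → f 0 + p) (trans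
      (sum-cong-≗ {N} (λ j → cong (λ c → if c then f (suc (toℕ j)) else b) (does-⇔ (mk⇔ ℕ.≤-pred s≤s) (suc (toℕ j) ℕ.<? suc l) (toℕ j ℕ.<? l))))
      (∑-if {N} {l} (f ∘ suc) b l≤N)))
    (alg (f 0) (∑[ j < l ] f (suc (toℕ j))) (ι N) (ι l) b)
    where
    alg : ∀ a s n l b → a + (s + (n - l) * b) ≡ a + s + (1ℚ + n - (1ℚ + l)) * b
    alg = solve-∀ ℚ-ring

  ∑-const : ∀ m c → ∑[ j < m ] c ≡ ι m * c
  ∑-const zero    c = sym (*-zeroˡ c)
  ∑-const (suc m) c = trans (cong (λ p → c + p) (∑-const m c)) (alg (ι m) c)
    where
    alg : ∀ a c → c + a * c ≡ (1ℚ + a) * c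
    alg = solve-∀ ℚ-ring

  -- Stated with `<?` and a conditional, which is the shape that `∑-if` sums.
  toℕ-punchIn : ∀ {m} (j : Fin (suc m)) (r : Fin m) →
                toℕ (punchIn j r) ≡ (if does (toℕ j ℕ.<? suc (toℕ r)) then suc (toℕ r) else toℕ r)
  toℕ-punchIn zero    r       = refl
  toℕ-punchIn (suc j) zero    = refl
  toℕ-punchIn (suc j) (suc r) = trans (cong suc (toℕ-punchIn j r)) (suc-if (toℕ j) (toℕ r))
    where
    suc-if : ∀ j r → suc (if does (j ℕ.<? suc r) then suc r else r) ≡ (if does (suc j ℕ.<? suc (suc r)) then suc (suc r) else suc r)
    suc-if j r rewrite does-⇔ (mk⇔ ℕ.≤-pred s≤s) (suc j ℕ.<? suc (suc r)) (j ℕ.<? suc r) with does (j ℕ.<? suc r)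
    ... | true  = refl
    ... | false = refl

  -- Stopping rules that depend on time and relative rank

  module Stopping {Acc : ℕ → ℕ → Set} (acc? : ∀ i r → Dec (Acc i r))
    (n′ : ℕ) (P : ℕ → ℕ → ℚ) (u : ℚ)
    (P-step : ∀ m r → m ℕ.< suc n′ → ι (suc m) * P m r ≡ ι (suc r) * P (suc m) (suc r) + (ι (suc m) - ι (suc r)) * P (suc m) r)
    (u-last : ι (suc n′) * u ≡ ∑[ j < suc n′ ] P (suc n′) (toℕ j)) where

    -- value N m is the conditional probability of success when the first m candidates have been
    -- passed over, where suc N candidates are left.
    value : ℕ → ℕ → ℚ
    value zero    m = u
    value (suc N) m = inv m * ∑[ j < suc m ] (if does (acc? m (suc (toℕ j))) then P (suc m) (toℕ j) else value N (suc m))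

    U : ℕ → ℚ
    U m = value (n′ ∸ m) m

    U-step : ∀ m → m ℕ.< n′ →
      ι (suc m) * U m ≡ ∑[ j < suc m ] (if does (acc? m (suc (toℕ j))) then P (suc m) (toℕ j) else U (suc m))
    U-step m m<n′ = trans (cong (λ N → ι (suc m) * value N m) (ℕ.+-∸-assoc 1 m<n′))
      (alg (ι (suc m)) (inv m) (∑[ j < suc m ] (if does (acc? m (suc (toℕ j))) then P (suc m) (toℕ j) else U (suc m))) (inv-inverse m))
      where
      alg : ∀ a i x → i * a ≡ 1ℚ → a * (i * x) ≡ x
      alg a i x h = lincomb₁ x h (solve (a ∷ i ∷ x ∷ []) ℚ-ring)

    U-last : ι (suc n′) * U n′ ≡ ∑[ j < suc n′ ] P (suc n′) (toℕ j)
    U-last = trans (cong (λ N → ι (suc n′) * value N n′) (ℕ.n∸n≡0 n′)) u-last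

    stop : ∀ {m} → Permutation′ m → Maybe (Fin m)
    stop {m} π = find (λ i → acc? (toℕ i) (relativeRank π i)) (allFin m)

    stop-insert : ∀ {m} (j : Fin (suc m)) (π : Permutation′ m) → stop (insert (fromℕ m) j π) ≡
      Maybe.map inject₁ (stop π) <∣> (if does (acc? m (suc (toℕ j))) then just (fromℕ m) else nothing)
    stop-insert {m} j π = trans (find-tabulate-snoc π′? (λ i → i)) (cong₂ _<∣>_
      (find-tabulate-map π? π′? inject₁ (λ i → cong₂ (λ a b → does (acc? a b)) (toℕ-inject₁ i) (relativeRank-inject₁ j π i)) (λ i → i))
      (cong₂ (λ a b → if does (acc? a b) then just (fromℕ m) else nothing) (toℕ-fromℕ m) (relativeRank-fromℕ j π)))
      where
      π? : ∀ i → Dec (Acc (toℕ i) (relativeRank π i))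
      π? i = acc? (toℕ i) (relativeRank π i)
      π′? : ∀ i → Dec (Acc (toℕ i) (relativeRank (insert (fromℕ m) j π) i))
      π′? i = acc? (toℕ i) (relativeRank (insert (fromℕ m) j π) i)

    -- The conditional probability of success given the relative order π of the first m candidates.
    V : ∀ {m} → Permutation′ m → ℚ
    V {m} π = maybe (λ i → P m (toℕ (π ⟨$⟩ʳ i))) (U m) (stop π)

    ∑-punchIn : ∀ m (r : Fin m) → m ℕ.< suc n′ → ∑[ j < suc m ] P (suc m) (toℕ (punchIn j r)) ≡ ι (suc m) * P m (toℕ r)
    ∑-punchIn m r m<n = begin
      ∑[ j < suc m ] P (suc m) (toℕ (punchIn j r))
        ≡⟨ sum-cong-≗ {suc m} (λ j → trans (cong (P (suc m)) (toℕ-punchIn j r)) (P-if (does (toℕ j ℕ.<? suc (toℕ r))))) ⟩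
      ∑[ j < suc m ] (if does (toℕ j ℕ.<? suc (toℕ r)) then P (suc m) (suc (toℕ r)) else P (suc m) (toℕ r))
        ≡⟨ ∑-if {suc m} {suc (toℕ r)} (λ _ → P (suc m) (suc (toℕ r))) (P (suc m) (toℕ r)) (s≤s (ℕ.<⇒≤ (toℕ<n r))) ⟩
      ∑[ j < suc (toℕ r) ] P (suc m) (suc (toℕ r)) + (ι (suc m) - ι (suc (toℕ r))) * P (suc m) (toℕ r)
        ≡⟨ cong (_+ (ι (suc m) - ι (suc (toℕ r))) * P (suc m) (toℕ r)) (∑-const (suc (toℕ r)) (P (suc m) (suc (toℕ r)))) ⟩
      ι (suc (toℕ r)) * P (suc m) (suc (toℕ r)) + (ι (suc m) - ι (suc (toℕ r))) * P (suc m) (toℕ r)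
        ≡⟨ P-step m (toℕ r) m<n ⟨
      ι (suc m) * P m (toℕ r) ∎
      where
      open ≡-Reasoning
      P-if : ∀ b → P (suc m) (if b then suc (toℕ r) else toℕ r) ≡ (if b then P (suc m) (suc (toℕ r)) else P (suc m) (toℕ r))
      P-if true  = refl
      P-if false = refl

    -- The martingale property of `V`. If a candidate has been selected, only its relative rank can
    -- change, which is `P-step`; otherwise it is the recurrence defining `value`.
    V-step : ∀ {m} → m ℕ.< n′ → (π : Permutation′ m) → ∑[ j < suc m ] V (insert (fromℕ m) j π) ≡ ι (suc m) * V π
    V-step {m} m<n′ π = trans
      (sum-cong-≗ {suc m} (λ j → cong (maybe (λ i → P (suc m) (toℕ (insert (fromℕ m) j π ⟨$⟩ʳ i))) (U (suc m))) (stop-insert j π)))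
      (cases (stop π))
      where
      cases : ∀ (x : Maybe (Fin m)) →
        ∑[ j < suc m ] maybe (λ i → P (suc m) (toℕ (insert (fromℕ m) j π ⟨$⟩ʳ i))) (U (suc m))
          (Maybe.map inject₁ x <∣> (if does (acc? m (suc (toℕ j))) then just (fromℕ m) else nothing))
        ≡ ι (suc m) * maybe (λ i → P m (toℕ (π ⟨$⟩ʳ i))) (U m) x
      cases (just i) = trans (sum-cong-≗ {suc m} (λ j → cong (λ r → P (suc m) (toℕ r)) (insert-inject₁ j π i)))
                             (∑-punchIn m (π ⟨$⟩ʳ i) (ℕ.m<n⇒m<1+n m<n′))
      cases nothing  = trans (sum-cong-≗ {suc m} term) (sym (U-step m m<n′))
        where
        term : ∀ j → maybe (λ i → P (suc m) (toℕ (insert (fromℕ m) j π ⟨$⟩ʳ i))) (U (suc m))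
                       (if does (acc? m (suc (toℕ j))) then just (fromℕ m) else nothing)
                     ≡ (if does (acc? m (suc (toℕ j))) then P (suc m) (toℕ j) else U (suc m))
        term j with does (acc? m (suc (toℕ j)))
        ... | true  = cong (λ r → P (suc m) (toℕ r)) (insert-fromℕ j π)
        ... | false = refl

    ∑-V : ∀ m → m ℕ.≤ n′ → ∑ₗ V (orderings m) ≡ ι (m !) * U 0
    ∑-V zero    _    = trans (+-identityʳ (U 0)) (sym (*-identityˡ (U 0)))
    ∑-V (suc m) m<n′ = begin
      ∑ₗ V (orderings (suc m))                                             ≡⟨ ∑ₗ-orderings m V ⟩
      ∑ₗ (λ π → ∑[ j < suc m ] V (insert (fromℕ m) j π)) (orderings m)     ≡⟨ ∑ₗ-cong (V-step m<n′) (orderings m) ⟩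
      ∑ₗ (λ π → ι (suc m) * V π) (orderings m)                             ≡⟨ ∑ₗ-* (ι (suc m)) V (orderings m) ⟩
      ι (suc m) * ∑ₗ V (orderings m)                                       ≡⟨ cong (ι (suc m) *_) (∑-V m (ℕ.<⇒≤ m<n′)) ⟩
      ι (suc m) * (ι (m !) * U 0)                                          ≡⟨ *-assoc (ι (suc m)) (ι (m !)) (U 0) ⟨
      ι (suc m) * ι (m !) * U 0                                            ≡⟨ cong (_* U 0) (ι-* (suc m) (m !)) ⟨
      ι (suc m !) * U 0                                                    ∎
      where open ≡-Reasoning

    selected : Permutation′ (suc n′) → Fin (suc n′)
    selected π = fromMaybe (fromℕ n′) (stop π)

    P-selected : Permutation′ (suc n′) → ℚ
    P-selected π = P (suc n′) (toℕ (π ⟨$⟩ʳ selected π))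

    P-selected-step : (π : Permutation′ n′) → ∑[ j < suc n′ ] P-selected (insert (fromℕ n′) j π) ≡ ι (suc n′) * V π
    P-selected-step π = trans
      (sum-cong-≗ {suc n′} (λ j → cong (λ x → P (suc n′) (toℕ (insert (fromℕ n′) j π ⟨$⟩ʳ fromMaybe (fromℕ n′) x))) (stop-insert j π)))
      (cases (stop π))
      where
      cases : ∀ (x : Maybe (Fin n′)) →
        ∑[ j < suc n′ ] P (suc n′) (toℕ (insert (fromℕ n′) j π ⟨$⟩ʳ fromMaybe (fromℕ n′)
          (Maybe.map inject₁ x <∣> (if does (acc? n′ (suc (toℕ j))) then just (fromℕ n′) else nothing))))
        ≡ ι (suc n′) * maybe (λ i → P n′ (toℕ (π ⟨$⟩ʳ i))) (U n′) x
      cases (just i) = trans (sum-cong-≗ {suc n′} (λ j → cong (λ r → P (suc n′) (toℕ r)) (insert-inject₁ j π i)))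
                             (∑-punchIn n′ (π ⟨$⟩ʳ i) ℕ.≤-refl)
      -- The newcomer is selected in either case: if it is acceptable by the rule, and if not by the
      -- default of `fromMaybe`. Hence acceptability drops out and `u` is the plain average.
      cases nothing  = trans (sum-cong-≗ {suc n′} (λ j → trans
          (cong (λ i → P (suc n′) (toℕ (insert (fromℕ n′) j π ⟨$⟩ʳ i))) (fromMaybe-if (does (acc? n′ (suc (toℕ j))))))
          (cong (λ r → P (suc n′) (toℕ r)) (insert-fromℕ j π))))
        (sym U-last)
        where
        fromMaybe-if : ∀ b → fromMaybe (fromℕ n′) (if b then just (fromℕ n′) else nothing) ≡ fromℕ n′
        fromMaybe-if true  = refl
        fromMaybe-if false = refl

    ∑-P-selected : ∑ₗ P-selected (orderings (suc n′)) ≡ ι (suc n′ !) * U 0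
    ∑-P-selected = begin
      ∑ₗ P-selected (orderings (suc n′))
        ≡⟨ ∑ₗ-orderings n′ P-selected ⟩
      ∑ₗ (λ π → ∑[ j < suc n′ ] P-selected (insert (fromℕ n′) j π)) (orderings n′)
        ≡⟨ ∑ₗ-cong P-selected-step (orderings n′) ⟩
      ∑ₗ (λ π → ι (suc n′) * V π) (orderings n′)
        ≡⟨ ∑ₗ-* (ι (suc n′)) V (orderings n′) ⟩
      ι (suc n′) * ∑ₗ V (orderings n′)
        ≡⟨ cong (ι (suc n′) *_) (∑-V n′ ℕ.≤-refl) ⟩
      ι (suc n′) * (ι (n′ !) * U 0)
        ≡⟨ *-assoc (ι (suc n′)) (ι (n′ !)) (U 0) ⟨
      ι (suc n′) * ι (n′ !) * U 0
        ≡⟨ cong (_* U 0) (ι-* (suc n′) (n′ !)) ⟨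
      ι (suc n′ !) * U 0 ∎
      where open ≡-Reasoning

  -- The success probability of a policy in closed form

  module Policy (n′ k : ℕ) (1≤k : 1 ℕ.≤ k) (k≤n′ : k ℕ.≤ n′) where

    open Hypergeometric n′ k 1≤k k≤n′ public
    open Secretary n k (s≤s k≤n′) public

    -- `N` stands for k - l: it decreases while l increases, so that the recursion is structural and
    -- ends with `δ` at l = k.
    W : (ℕ → ℕ) → ℕ → ℕ → ℚ
    W t l zero    = δ k n
    W t l (suc N) = dq l (t (suc l)) + ι (t (suc l)) * W t (suc l) N

    P-last : ∀ r → P n r ≡ ι (𝟙 (does (suc r ℕ.≤? k)))
    P-last r = [ (λ k≤r → trans (P-last-failure r k≤r) (cong (λ b → ι (𝟙 b)) (sym (dec-false (suc r ℕ.≤? k) (ℕ.≤⇒≯ k≤r)))))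
               , (λ r<k → trans (P-last-success r r<k) (cong (λ b → ι (𝟙 b)) (sym (dec-true (suc r ℕ.≤? k) r<k))))
               ]′ (ℕ.≤-<-connex k r)

    u-last : ι n * (ι k * inv n′) ≡ ∑[ j < n ] P n (toℕ j)
    u-last = begin
      ι n * (ι k * inv n′)
        ≡⟨ alg (ι n) (ι k) (inv n′) (inv-inverse n′) ⟩
      ι k * 1ℚ + (ι n - ι k) * 0ℚ
        ≡⟨ cong (_+ (ι n - ι k) * 0ℚ) (∑-const k 1ℚ) ⟨
      ∑[ j < k ] 1ℚ + (ι n - ι k) * 0ℚ
        ≡⟨ ∑-if {n} {k} (λ _ → 1ℚ) 0ℚ k≤n ⟨
      ∑[ j < n ] (if does (toℕ j ℕ.<? k) then 1ℚ else 0ℚ)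
        ≡⟨ sum-cong-≗ {n} (λ j → trans (ι-𝟙 (does (toℕ j ℕ.<? k))) (sym (P-last (toℕ j)))) ⟩
      ∑[ j < n ] P n (toℕ j) ∎
      where
      open ≡-Reasoning
      alg : ∀ a c v → v * a ≡ 1ℚ → a * (c * v) ≡ c * 1ℚ + (a - c) * 0ℚ
      alg a c v h = lincomb₁ c h (solve (a ∷ c ∷ v ∷ []) ℚ-ring)
      ι-𝟙 : ∀ b → (if b then 1ℚ else 0ℚ) ≡ ι (𝟙 b)
      ι-𝟙 true  = refl
      ι-𝟙 false = refl

    ∑P-∑ : ∀ m l → ∑[ j < l ] P m (toℕ j) ≡ ∑P m l
    ∑P-∑ m zero    = refl
    ∑P-∑ m (suc l) = trans (∑-snoc l (P m)) (cong (_+ P m l) (∑P-∑ m l))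

    module _ (s t : ℕ → ℕ) (adm : IsAdmissible s) (s≡t : ∀ l → suc l ℕ.≤ k → s (suc l) ≡ l ℕ.+ t (suc l)) where

      extend-≤ : ∀ l → l ℕ.≤ k → extend s l ≡ s l
      extend-≤ l l≤k = cong (λ b → if b then s l else n′) (dec-true (l ℕ.≤? k) l≤k)

      extend-> : ∀ l → k ℕ.< l → extend s l ≡ n′
      extend-> l k<l = cong (λ b → if b then s l else n′) (dec-false (l ℕ.≤? k) (ℕ.<⇒≱ k<l))

      extend≤n′ : ∀ l → 1 ℕ.≤ l → extend s l ℕ.≤ n′
      extend≤n′ l 1≤l with ℕ.≤-<-connex l k
      ... | inj₁ l≤k = subst (ℕ._≤ n′) (sym (extend-≤ l l≤k)) (ℕ.≤-pred (proj₂ (proj₁ adm l 1≤l l≤k)))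
      ... | inj₂ k<l = ℕ.≤-reflexive (extend-> l k<l)

      extend-mono : ∀ l m → 1 ℕ.≤ l → l ℕ.≤ m → extend s l ℕ.≤ extend s m
      extend-mono l m 1≤l l≤m with ℕ.≤-<-connex m k
      ... | inj₁ m≤k = subst₂ ℕ._≤_ (sym (extend-≤ l (ℕ.≤-trans l≤m m≤k))) (sym (extend-≤ m m≤k)) (proj₂ adm l m 1≤l l≤m m≤k)
      ... | inj₂ k<m = subst (extend s l ℕ.≤_) (sym (extend-> m k<m)) (extend≤n′ l 1≤l)

      AccAt : ℕ → ℕ → Fin k → Set
      AccAt i r p = let l = suc (toℕ p) in
        extend s l ℕ.< suc i × suc i ℕ.≤ extend s (suc l) × r ℕ.≤ l

      accAt? : ∀ i r p → Dec (AccAt i r p)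
      accAt? i r p = let l = suc (toℕ p) in
        (extend s l ℕ.<? suc i) ×-dec ((suc i ℕ.≤? extend s (suc l)) ×-dec (r ℕ.≤? l))

      Acc : ℕ → ℕ → Set
      Acc i r = ∃[ p ] AccAt i r p

      acc? : ∀ i r → Dec (Acc i r)
      acc? i r = any? (accAt? i r)

      -- A window later than the l-th cannot be open, since `extend s` is nondecreasing and m is
      -- below its value at `suc l`; an earlier window would only give a stricter bound on the rank.
      -- The case l = 0 is the initial phase, in which every candidate is passed over.
      acc⇔ : ∀ l m j → l ℕ.≤ k → (1 ℕ.≤ l → s l ℕ.≤ m) → m ℕ.< extend s (suc l) →
             does (acc? m (suc j)) ≡ does (j ℕ.<? l)
      acc⇔ l m j l≤k lo hi = does-⇔ (mk⇔ to (from l l≤k lo hi)) (acc? m (suc j)) (j ℕ.<? l)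
        where
        to : Acc m (suc j) → j ℕ.< l
        to (p , below , _ , j<p) with ℕ.≤-<-connex (suc (toℕ p)) l
        ... | inj₁ p≤l = ℕ.≤-trans j<p p≤l
        ... | inj₂ l<p = contradiction (ℕ.≤-trans hi (extend-mono (suc l) (suc (toℕ p)) (s≤s z≤n) l<p)) (ℕ.<⇒≱ below)
        from : ∀ l → l ℕ.≤ k → (1 ℕ.≤ l → s l ℕ.≤ m) → m ℕ.< extend s (suc l) → j ℕ.< l → Acc m (suc j)
        from (suc l) l<k lo hi j<l = fromℕ< l<k ,
          subst (λ i → extend s (suc i) ℕ.< suc m × suc m ℕ.≤ extend s (suc (suc i)) × suc j ℕ.≤ suc i) (sym (toℕ-fromℕ< l<k))
            (s≤s (subst (ℕ._≤ m) (sym (extend-≤ (suc l) l<k)) (lo (s≤s z≤n))) , hi , j<l)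

      module Closed {Acc : ℕ → ℕ → Set} (acc? : ∀ i r → Dec (Acc i r))
        (acc⇔ : ∀ l m j → l ℕ.≤ k → (1 ℕ.≤ l → s l ℕ.≤ m) → m ℕ.< extend s (suc l) →
                does (acc? m (suc j)) ≡ does (j ℕ.<? l)) where

        open Stopping acc? n′ P (ι k * inv n′) P-step u-last

        -- Backward induction: N is the number of candidates after the first m, not counting the last
        -- one, and D the number of thresholds from s (suc l) on.
        value-closed : ∀ N D l x → l ℕ.+ D ≡ k → l ℕ.+ x ℕ.+ N ≡ n′ →
          (1 ℕ.≤ l → s l ℕ.≤ l ℕ.+ x) → l ℕ.+ x ℕ.≤ extend s (suc l) →
          value N (l ℕ.+ x) ≡ A l (l ℕ.+ x) - rise x l * W t l D

        closed-cases : ∀ N D l x → l ℕ.+ D ≡ k → l ℕ.+ x ℕ.+ N ≡ n′ → (1 ℕ.≤ l → s l ℕ.≤ l ℕ.+ x) →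
          l ℕ.+ x ℕ.< extend s (suc l) ⊎ l ℕ.+ x ≡ extend s (suc l) →
          value N (l ℕ.+ x) ≡ A l (l ℕ.+ x) - rise x l * W t l D
        value-closed N D l x l+D≡k m+N≡n′ lo hi = closed-cases N D l x l+D≡k m+N≡n′ lo (ℕ.m≤n⇒m<n∨m≡n hi)

        closed-cases zero D l x l+D≡k m+N≡n′ lo (inj₁ m<ext) =
          contradiction (extend≤n′ (suc l) (s≤s z≤n)) (ℕ.<⇒≱ (subst (ℕ._< extend s (suc l)) (trans (sym (ℕ.+-identityʳ (l ℕ.+ x))) m+N≡n′) m<ext))
        -- Inside a window one step of the recurrence is taken: `A-step` treats the particular
        -- solution, `rise-suc` the multiple of the homogeneous one.
        closed-cases (suc N) D l x l+D≡k m+N≡n′ lo (inj₁ m<ext) = begin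
          inv m * ∑[ j < suc m ] (if does (acc? m (suc (toℕ j))) then P (suc m) (toℕ j) else value N (suc m))
            ≡⟨ cong (inv m *_) (sum-cong-≗ {suc m} (λ j → cong (λ b → if b then P (suc m) (toℕ j) else value N (suc m)) (acc⇔ l m (toℕ j) l≤k lo m<ext))) ⟩
          inv m * ∑[ j < suc m ] (if does (toℕ j ℕ.<? l) then P (suc m) (toℕ j) else value N (suc m))
            ≡⟨ cong (inv m *_) (trans (∑-if {suc m} {l} (P (suc m)) (value N (suc m)) (ℕ.m≤n⇒m≤1+n (ℕ.m≤m+n l x)))
                 (cong₂ (λ a v → a + (ι (suc m) - ι l) * v) (∑P-∑ (suc m) l) ih)) ⟩
          inv m * (∑P (suc m) l + (ι (suc m) - ι l) * (A l (suc m) - rise (suc x) l * W t l D))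
            ≡⟨ alg (ι (suc m)) (ι l) (ι (suc x)) (inv m) (∑P (suc m) l) (A l m) (A l (suc m)) (rise x l) (rise (suc x) l) (W t l D)
                 (inv-inverse m) (A-step l m m<n) (trans (*-comm (ι (suc m)) (rise x l)) (rise-suc x l))
                 (trans (cong ι (sym (ℕ.+-suc l x))) (ι-+ l (suc x))) ⟩
          A l m - rise x l * W t l D ∎
          where
          open ≡-Reasoning
          m : ℕ
          m = l ℕ.+ x
          l≤k : l ℕ.≤ k
          l≤k = ℕ.m+n≤o⇒m≤o l (ℕ.≤-reflexive l+D≡k)
          m<n : suc m ℕ.< n
          m<n = s≤s (ℕ.≤-trans m<ext (extend≤n′ (suc l) (s≤s z≤n)))
          ih : value N (suc m) ≡ A l (suc m) - rise (suc x) l * W t l D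
          ih = subst (λ m → value N m ≡ A l m - rise (suc x) l * W t l D) (ℕ.+-suc l x)
            (value-closed N D l (suc x) l+D≡k (trans (cong (ℕ._+ N) (ℕ.+-suc l x)) (trans (sym (ℕ.+-suc m N)) m+N≡n′))
              (λ 1≤l → ℕ.≤-trans (lo 1≤l) (ℕ.+-monoʳ-≤ l (ℕ.n≤1+n x))) (subst (ℕ._≤ extend s (suc l)) (sym (ℕ.+-suc l x)) m<ext))
          alg : ∀ M l y i p a a′ r r′ w → i * M ≡ 1ℚ → M * a ≡ p + (M - l) * a′ → M * r ≡ y * r′ → M ≡ l + y →
                i * (p + (M - l) * (a′ - r′ * w)) ≡ a - r * w
          alg M l y i p a a′ r r′ w hi ha hr refl = lincomb₃ (a - r * w) (- i) (i * w) hi ha hr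
            (solve (l ∷ y ∷ i ∷ p ∷ a ∷ a′ ∷ r ∷ r′ ∷ w ∷ []) ℚ-ring)
        -- Now l = k, and the last window ends at n′, where only the last candidate is left:
        -- `A-last` applies.
        closed-cases N zero l x l+D≡k m+N≡n′ lo (inj₂ m≡ext) = begin
          value N (l ℕ.+ x)                                   ≡⟨ cong (λ N → value N (l ℕ.+ x)) N≡0 ⟩
          ι k * inv n′                                        ≡⟨ alg (ι k * inv n′) (A k n′) (δ k n) (rise (n′ ∸ k) k) A-last ⟩
          A k n′ - rise (n′ ∸ k) k * δ k n                    ≡⟨ cong₂ (λ m y → A k m - rise y k * δ k n) m≡n′ x≡ ⟨
          A k (l ℕ.+ x) - rise x k * δ k n                    ≡⟨ cong (λ i → A i (l ℕ.+ x) - rise x i * δ k n) l≡k ⟨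
          A l (l ℕ.+ x) - rise x l * δ k n                    ∎
          where
          open ≡-Reasoning
          l≡k : l ≡ k
          l≡k = trans (sym (ℕ.+-identityʳ l)) l+D≡k
          m≡n′ : l ℕ.+ x ≡ n′
          m≡n′ = trans m≡ext (extend-> (suc l) (s≤s (ℕ.≤-reflexive (sym l≡k))))
          N≡0 : N ≡ 0
          N≡0 = ℕ.+-cancelˡ-≡ (l ℕ.+ x) N 0 (trans m+N≡n′ (trans (sym m≡n′) (sym (ℕ.+-identityʳ (l ℕ.+ x)))))
          x≡ : x ≡ n′ ∸ k
          x≡ = trans (sym (ℕ.m+n∸m≡n l x)) (cong₂ _∸_ m≡n′ l≡k)
          alg : ∀ c a d r → a ≡ c + d * r → c ≡ a - r * d
          alg c a d r refl = solve (c ∷ d ∷ r ∷ []) ℚ-ring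
        -- At m = s (suc l) the solution for l must agree with that for `suc l`. Time stands still
        -- and only `D` decreases, so coinciding thresholds are crossed one after another. As x = t
        -- (suc l) is positive, m can be rewritten as suc l + y with x = suc y.
        closed-cases N (suc D) l x l+D≡k m+N≡n′ lo (inj₂ m≡ext) = cases x x≡t m+N≡n′ m≡s
          where
          l<k : suc l ℕ.≤ k
          l<k = ℕ.m+n≤o⇒m≤o (suc l) (ℕ.≤-reflexive (trans (sym (ℕ.+-suc l D)) l+D≡k))
          m≡s : l ℕ.+ x ≡ s (suc l)
          m≡s = trans m≡ext (extend-≤ (suc l) l<k)
          x≡t : x ≡ t (suc l)
          x≡t = ℕ.+-cancelˡ-≡ l x (t (suc l)) (trans m≡s (s≡t l l<k))
          cases : ∀ x → x ≡ t (suc l) → l ℕ.+ x ℕ.+ N ≡ n′ → l ℕ.+ x ≡ s (suc l) →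
                  value N (l ℕ.+ x) ≡ A l (l ℕ.+ x) - rise x l * (dq l (t (suc l)) + ι (t (suc l)) * W t (suc l) D)
          cases zero _ _ eq = contradiction (proj₁ (proj₁ adm (suc l) (s≤s z≤n) l<k))
            (ℕ.<⇒≱ (s≤s (ℕ.≤-reflexive (trans (sym eq) (ℕ.+-identityʳ l)))))
          cases (suc y) eq m+N≡n′ m≡s = begin
            value N (l ℕ.+ suc y)
              ≡⟨ cong (value N) (ℕ.+-suc l y) ⟩
            value N (suc l ℕ.+ y)
              ≡⟨ value-closed N D (suc l) y (trans (sym (ℕ.+-suc l D)) l+D≡k) (trans (cong (ℕ._+ N) (sym (ℕ.+-suc l y))) m+N≡n′)
                   (λ _ → ℕ.≤-reflexive (trans (sym m≡s) (ℕ.+-suc l y)))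
                   (subst (ℕ._≤ extend s (2 ℕ.+ l)) (trans (extend-≤ (suc l) l<k) (trans (sym m≡s) (ℕ.+-suc l y)))
                     (extend-mono (suc l) (2 ℕ.+ l) (s≤s z≤n) (ℕ.n≤1+n (suc l)))) ⟩
            A (suc l) (suc l ℕ.+ y) - rise y (suc l) * W t (suc l) D
              ≡⟨ cong₂ (λ a r → a - r * W t (suc l) D)
                   (trans (cong (A (suc l)) (sym (ℕ.+-suc l y))) (A-next l (suc y) m<n)) (rise-suc y l) ⟩
            A l (l ℕ.+ suc y) - rise (suc y) l * dq l (suc y) - ι (suc y) * rise (suc y) l * W t (suc l) D
              ≡⟨ alg (A l (l ℕ.+ suc y)) (rise (suc y) l) (dq l (suc y)) (ι (suc y)) (W t (suc l) D) ⟩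
            A l (l ℕ.+ suc y) - rise (suc y) l * (dq l (suc y) + ι (suc y) * W t (suc l) D)
              ≡⟨ cong (λ z → A l (l ℕ.+ suc y) - rise (suc y) l * (dq l z + ι z * W t (suc l) D)) eq ⟩
            A l (l ℕ.+ suc y) - rise (suc y) l * (dq l (t (suc l)) + ι (t (suc l)) * W t (suc l) D) ∎
            where
            open ≡-Reasoning
            m<n : l ℕ.+ suc y ℕ.< n
            m<n = s≤s (subst (l ℕ.+ suc y ℕ.≤_) m+N≡n′ (ℕ.m≤m+n (l ℕ.+ suc y) N))
            alg : ∀ a r d y w → a - r * d - y * r * w ≡ a - r * (d + y * w)
            alg = solve-∀ ℚ-ring

      module S = Stopping acc? n′ P (ι k * inv n′) P-step u-last

      Pr≡U : Pr (success? s) ≡ S.U 0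
      Pr≡U = *-cancelʳ (ι (n !)) {{ !-nonZero n }} (begin
        Pr (success? s) * ι (n !)
          ≡⟨ /-*-cancel (+ length (filter (success? s) (orderings n))) (n !) {{n ℕ.!≢0}} ⟩
        ℤ→ℚ (+ length (filter (success? s) (orderings n)))
          ≡⟨ ι≡/1 (length (filter (success? s) (orderings n))) ⟨
        ι (length (filter (success? s) (orderings n)))
          ≡⟨ length-filter-∑ₗ (success? s) (orderings n) ⟩
        ∑ₗ (λ π → ι (𝟙 (does (success? s π)))) (orderings n)
          ≡⟨ ∑ₗ-cong (λ π → P-last (toℕ (π ⟨$⟩ʳ S.selected π))) (orderings n) ⟨
        ∑ₗ S.P-selected (orderings n)
          ≡⟨ S.∑-P-selected ⟩
        ι (n !) * S.U 0
          ≡⟨ *-comm (ι (n !)) (S.U 0) ⟩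
        S.U 0 * ι (n !) ∎)
        where open ≡-Reasoning

      Pr≡-W : Pr (success? s) ≡ - W t 0 k
      Pr≡-W = trans Pr≡U (trans (Closed.value-closed acc? acc⇔ n′ k 0 0 refl refl (λ ()) z≤n) (alg (W t 0 k)))
        where
        alg : ∀ w → 0ℚ - 1ℚ * w ≡ - w
        alg = solve-∀ ℚ-ring

  -- Bounded search for a least element

  module _ {Q : Pred ℕ 0ℓ} (Q? : Decidable Q) where

    -- The last candidate value x + f is returned untested; `firstFrom-least` justifies this by
    -- assuming a solution within the range.
    firstFrom : ℕ → ℕ → ℕ
    firstFrom x zero    = x
    firstFrom x (suc f) = if does (Q? x) then x else firstFrom (suc x) f

    firstFrom-least : ∀ x f {y} → x ℕ.≤ y → y ℕ.≤ x ℕ.+ f → Q y →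
      Q (firstFrom x f) × x ℕ.≤ firstFrom x f × firstFrom x f ℕ.≤ x ℕ.+ f × (∀ z → x ℕ.≤ z → Q z → firstFrom x f ℕ.≤ z)
    firstFrom-least x zero x≤y y≤x Qy =
      subst Q (ℕ.≤-antisym (ℕ.≤-trans y≤x (ℕ.≤-reflexive (ℕ.+-identityʳ x))) x≤y) Qy , ℕ.≤-refl , ℕ.m≤m+n x 0 , λ z x≤z _ → x≤z
    firstFrom-least x (suc f) {y} x≤y y≤ Qy with Q? x
    ... | yes Qx = Qx , ℕ.≤-refl , ℕ.m≤m+n x (suc f) , λ z x≤z _ → x≤z
    ... | no ¬Qx =
      let x< : ∀ {z} → x ℕ.≤ z → Q z → x ℕ.< z
          x< x≤z Qz = ℕ.≤∧≢⇒< x≤z λ x≡z → ¬Qx (subst Q (sym x≡z) Qz)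
          Qr , x<r , r≤ , least = firstFrom-least (suc x) f (x< x≤y Qy) (subst (y ℕ.≤_) (ℕ.+-suc x f) y≤) Qy
      in Qr , ℕ.<⇒≤ x<r , subst (firstFrom (suc x) f ℕ.≤_) (sym (ℕ.+-suc x f)) r≤ , λ z x≤z Qz → least z (x< x≤z Qz) Qz

  -- Existence and minimality of the thresholds

  module Thresholds (n′ k : ℕ) (1≤k : 1 ℕ.≤ k) (k≤n′ : k ℕ.≤ n′) where

    open Policy n′ k 1≤k k≤n′

    Good : ℕ → ℚ → ℕ → Set
    Good l w x = 1 ℕ.≤ x × x ℕ.≤ n ∸ l × ι l * dq l x ≤ w

    InRange : (ℕ → ℕ) → Set
    InRange t = ∀ l → 1 ℕ.≤ l → l ℕ.≤ k → 1 ℕ.≤ t l × t l ℕ.≤ n ∸ l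

    -- W t l N / l takes the place of bound t l, where N = k − l.
    LeastGood : (ℕ → ℕ) → Set
    LeastGood t = ∀ l N → 1 ℕ.≤ l → l ℕ.+ N ≡ k → IsLeast (Good l (W t l N)) (t l)

    private
      l≤k : ∀ {l N} → l ℕ.+ N ≡ k → l ℕ.≤ k
      l≤k {l} eq = ℕ.m+n≤o⇒m≤o l (ℕ.≤-reflexive eq)

      shift : ∀ {l N} → l ℕ.+ suc N ≡ k → suc l ℕ.+ N ≡ k
      shift {l} {N} eq = trans (sym (ℕ.+-suc l N)) eq

      ≤∸⇒+≤ : ∀ {l x} → l ℕ.≤ k → x ℕ.≤ n ∸ l → l ℕ.+ x ℕ.≤ n
      ≤∸⇒+≤ {l} {x} l≤k x≤ = subst (ℕ._≤ n) (ℕ.+-comm x l) (ℕ.m≤o∸n⇒m+n≤o x (ℕ.≤-trans l≤k k≤n) x≤)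

      +≤⇒≤∸ : ∀ {l x} → l ℕ.+ x ℕ.≤ n → x ℕ.≤ n ∸ l
      +≤⇒≤∸ {l} {x} le = ℕ.m+n≤o⇒m≤o∸n x (subst (ℕ._≤ n) (ℕ.+-comm l x) le)

    dq-difference : ∀ l y → suc l ℕ.+ y ℕ.< n → dq l y - dq l (suc y) ≡ ι (suc l) * dq (suc l) y
    dq-difference zero    y y<n = dq₀-step y y<n
    dq-difference (suc l) y y<n = dq-step l y (ℕ.<-trans (ℕ.n<1+n _) y<n)

    private
      dq-antitone′ : ∀ l x e → suc l ℕ.+ (x ℕ.+ e) ℕ.≤ n → dq (suc l) (x ℕ.+ e) ≤ dq (suc l) x
      dq-antitone′ l x zero    _   = ≤-reflexive (cong (dq (suc l)) (ℕ.+-identityʳ x))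
      dq-antitone′ l x (suc e) x≤n = ≤-trans
        (subst (λ y → dq (suc l) y ≤ dq (suc l) (x ℕ.+ e)) (sym (ℕ.+-suc x e)) (dq-antitone l (x ℕ.+ e) x<n))
        (dq-antitone′ l x e (ℕ.<⇒≤ x<n))
        where
        x<n : suc l ℕ.+ (x ℕ.+ e) ℕ.< n
        x<n = subst (ℕ._≤ n) (trans (cong (suc l ℕ.+_) (ℕ.+-suc x e)) (ℕ.+-suc (suc l) (x ℕ.+ e))) x≤n

      -- The differences of y ↦ dq l y + y w are w − (l + 1) dq (l + 1) y: they change sign at the
      -- least good x, so that x is a minimum.
      objective : ℕ → ℚ → ℕ → ℚ
      objective l w y = dq l y + ι y * w

      objective-difference : ∀ l w y → suc l ℕ.+ y ℕ.< n → objective l w (suc y) - objective l w y ≡ w - ι (suc l) * dq (suc l) y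
      objective-difference l w y y<n =
        alg (dq l y) (dq l (suc y)) (ι y) w (ι (suc l) * dq (suc l) y) (dq-difference l y y<n)
        where
        alg : ∀ d d′ a w e → d - d′ ≡ e → d′ + (1ℚ + a) * w - (d + a * w) ≡ w - e
        alg d d′ a w e refl = solve (d ∷ d′ ∷ a ∷ w ∷ []) ℚ-ring

      objective-increasing : ∀ l w x → suc l ℕ.≤ k → Good (suc l) w x → ∀ e → suc l ℕ.+ (x ℕ.+ e) ℕ.≤ n →
                             objective l w x ≤ objective l w (x ℕ.+ e)
      objective-increasing l w x l<k good zero    _   = ≤-reflexive (cong (objective l w) (sym (ℕ.+-identityʳ x)))
      objective-increasing l w x l<k good (suc e) x≤n = ≤-trans
        (objective-increasing l w x l<k good e (ℕ.<⇒≤ x<n))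
        (subst (λ y → objective l w (x ℕ.+ e) ≤ objective l w y) (sym (ℕ.+-suc x e))
          (≤-by (x≤y⇒0≤y-x (≤-trans (*-monoˡ-≤-nonNeg (ι (suc l)) {{ι-nonNeg (suc l)}} (dq-antitone′ l x e (ℕ.<⇒≤ x<n))) (proj₂ (proj₂ good))))
                (objective-difference l w (x ℕ.+ e) x<n)))
        where
        x<n : suc l ℕ.+ (x ℕ.+ e) ℕ.< n
        x<n = subst (ℕ._≤ n) (trans (cong (suc l ℕ.+_) (ℕ.+-suc x e)) (ℕ.+-suc (suc l) (x ℕ.+ e))) x≤n

      objective-decreasing : ∀ l w x → suc l ℕ.≤ k → IsLeast (Good (suc l) w) x → ∀ e y → 1 ℕ.≤ y → y ℕ.+ e ≡ x →
                             objective l w x ≤ objective l w y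
      objective-decreasing l w x l<k least zero    y 1≤y eq = ≤-reflexive (cong (objective l w) (trans (sym eq) (ℕ.+-identityʳ y)))
      objective-decreasing l w x l<k least (suc e) y 1≤y eq = ≤-trans
        (objective-decreasing l w x l<k least e (suc y) (s≤s z≤n) (trans (sym (ℕ.+-suc y e)) eq))
        (≤-by (x≤y⇒0≤y-x (ℚ.<⇒≤ (ℚ.≰⇒> not-good)))
              (trans (alg (objective l w y) (objective l w (suc y))) (trans (cong -_ (objective-difference l w y y<n)) (alg′ w (ι (suc l) * dq (suc l) y)))))
        where
        y<x : y ℕ.< x
        y<x = subst (y ℕ.<_) eq (subst (suc y ℕ.≤_) (sym (ℕ.+-suc y e)) (s≤s (ℕ.m≤m+n y e)))
        y<n : suc l ℕ.+ y ℕ.< n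
        y<n = ℕ.<-≤-trans (ℕ.+-monoʳ-< (suc l) y<x) (≤∸⇒+≤ l<k (proj₁ (proj₂ (proj₁ least))))
        not-good : ¬ (ι (suc l) * dq (suc l) y ≤ w)
        not-good le = contradiction (proj₂ least y (1≤y , +≤⇒≤∸ {suc l} (ℕ.<⇒≤ y<n) , le)) (ℕ.<⇒≱ y<x)
        alg : ∀ a b → a - b ≡ - (b - a)
        alg = solve-∀ ℚ-ring
        alg′ : ∀ a b → - (a - b) ≡ b - a
        alg′ = solve-∀ ℚ-ring

      objective-min : ∀ l w x y → suc l ℕ.≤ k → IsLeast (Good (suc l) w) x → 1 ℕ.≤ y → y ℕ.≤ n ∸ suc l →
                      objective l w x ≤ objective l w y
      objective-min l w x y l<k least 1≤y y≤ = [ above , below ]′ (ℕ.≤-total x y)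
        where
        above : x ℕ.≤ y → objective l w x ≤ objective l w y
        above x≤y = subst (λ y → objective l w x ≤ objective l w y) (ℕ.m+[n∸m]≡n x≤y)
          (objective-increasing l w x l<k (proj₁ least) (y ∸ x)
            (subst (λ y → suc l ℕ.+ y ℕ.≤ n) (sym (ℕ.m+[n∸m]≡n x≤y)) (≤∸⇒+≤ l<k y≤)))
        below : y ℕ.≤ x → objective l w x ≤ objective l w y
        below y≤x = objective-decreasing l w x l<k least (x ∸ y) y 1≤y (ℕ.m+[n∸m]≡n y≤x)

    -- Two comparisons: `objective-min` replaces t (suc l) by t′ (suc l) while the parameter W t
    -- (suc l) is kept; then the parameter is enlarged by induction, its coefficient t′ (suc l)
    -- being nonnegative.
    W-min : ∀ t t′ → LeastGood t → InRange t′ → ∀ N l → l ℕ.+ N ≡ k → W t l N ≤ W t′ l N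
    W-min t t′ least range zero    l eq = ≤-refl
    W-min t t′ least range (suc N) l eq = ≤-trans
      (objective-min l (W t (suc l) N) (t (suc l)) (t′ (suc l)) l<k (least (suc l) N (s≤s z≤n) (shift eq))
        (proj₁ (range (suc l) (s≤s z≤n) l<k)) (proj₂ (range (suc l) (s≤s z≤n) l<k)))
      (+-monoʳ-≤ (dq l (t′ (suc l))) (*-monoˡ-≤-nonNeg (ι (t′ (suc l))) {{ι-nonNeg (t′ (suc l))}} (W-min t t′ least range N (suc l) (shift eq))))
      where
      l<k : suc l ℕ.≤ k
      l<k = l≤k (shift {l} {N} eq)

    -- By `dq-step` the slack of the new inequality is the slack of `dq-ratio` plus x times the
    -- slack of the given one.
    good-suc : ∀ l w x → suc (suc l) ℕ.≤ k → Good (2 ℕ.+ l) w x → Good (suc l) (dq (suc l) x + ι x * w) (suc x)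
    good-suc l w x l<k (1≤x , x≤ , le) = s≤s z≤n , +≤⇒≤∸ {suc l} (subst (ℕ._≤ n) (sym (ℕ.+-suc (suc l) x)) x<n) ,
      ≤-by (0≤+ (x≤y⇒0≤y-x (dq-ratio l x x<n)) (0≤* (0≤ι x) (x≤y⇒0≤y-x le)))
        (alg (ι x) (ι l) (ι (suc l ℕ.+ x)) (dq (suc l) x) (dq (suc l) (suc x)) w (ι (2 ℕ.+ l) * dq (2 ℕ.+ l) x)
             (cong (λ p → 1ℚ + p) (ι-+ l x)) (dq-step l x x<n))
      where
      x<n : suc l ℕ.+ x ℕ.< n
      x<n = ≤∸⇒+≤ l<k x≤
      alg : ∀ a b m d d′ w e → m ≡ 1ℚ + (b + a) → d - d′ ≡ e →
            d + a * w - (1ℚ + b) * d′ ≡ ((1ℚ + a) * d - m * d′) + a * (w - e)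
      alg a b m d d′ w e refl refl = solve (a ∷ b ∷ d ∷ d′ ∷ w ∷ []) ℚ-ring

    good-top : Good k (δ k n) (n ∸ k)
    good-top = ℕ.m<n⇒0<n∸m (s≤s k≤n′) , ℕ.≤-refl , dq-top (n ∸ k) (ℕ.m+[n∸m]≡n k≤n)

    private
      good? : ∀ l w → Decidable (λ x → ι l * dq l x ≤ w)
      good? l w x = ι l * dq l x ℚ.≤? w

      leastGood : ℕ → ℚ → ℕ
      leastGood l w = firstFrom (good? l w) 1 (n ∸ l ∸ 1)

      leastGood-least : ∀ l w x → Good l w x → IsLeast (Good l w) (leastGood l w)
      leastGood-least l w x (1≤x , x≤ , le) =
        (proj₁ (proj₂ spec) , subst (leastGood l w ℕ.≤_) bound≡ (proj₁ (proj₂ (proj₂ spec))) , proj₁ spec) ,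
        λ y good → proj₂ (proj₂ (proj₂ spec)) y (proj₁ good) (proj₂ (proj₂ good))
        where
        bound≡ : 1 ℕ.+ (n ∸ l ∸ 1) ≡ n ∸ l
        bound≡ = ℕ.m+[n∸m]≡n (ℕ.≤-trans 1≤x x≤)
        spec : (ι l * dq l (leastGood l w) ≤ w) × 1 ℕ.≤ leastGood l w × leastGood l w ℕ.≤ 1 ℕ.+ (n ∸ l ∸ 1) ×
               (∀ y → 1 ℕ.≤ y → ι l * dq l y ≤ w → leastGood l w ℕ.≤ y)
        spec = firstFrom-least (good? l w) 1 (n ∸ l ∸ 1) 1≤x (subst (x ℕ.≤_) (sym bound≡) x≤) le

      -- Here N stands for k − l, and w N for W thresholds l N.
      w : ℕ → ℚ
      w zero    = δ k n
      w (suc N) = dq (k ∸ suc N) (leastGood (k ∸ N) (w N)) + ι (leastGood (k ∸ N) (w N)) * w N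

    -- The threshold for l depends on `W`, and `W` on the thresholds above l. Computing `w`
    -- beforehand breaks this circle; `W-thresholds` confirms that it is the intended value.
    thresholds : ℕ → ℕ
    thresholds l = leastGood l (w (k ∸ l))

    private
      k∸ : ∀ l N → l ℕ.+ N ≡ k → l ≡ k ∸ N
      k∸ l N eq = trans (sym (ℕ.m+n∸n≡m l N)) (cong (_∸ N) eq)

      ∸k : ∀ l N → l ℕ.+ N ≡ k → k ∸ l ≡ N
      ∸k l N eq = trans (cong (_∸ l) (sym eq)) (ℕ.m+n∸m≡n l N)

      W-thresholds : ∀ N l → l ℕ.+ N ≡ k → W thresholds l N ≡ w N
      W-thresholds zero    l eq = refl
      W-thresholds (suc N) l eq = trans
        (cong (λ v → dq l (thresholds (suc l)) + ι (thresholds (suc l)) * v) (W-thresholds N (suc l) (shift eq)))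
        (cong₂ (λ i x → dq i x + ι x * w N) (k∸ l (suc N) eq)
          (cong₂ leastGood (k∸ (suc l) N (shift eq)) (cong w (∸k (suc l) N (shift eq)))))

      leastGood-w : ∀ N l → 1 ℕ.≤ l → l ℕ.+ N ≡ k → IsLeast (Good l (w N)) (leastGood l (w N))
      leastGood-w zero l 1≤l eq = subst (λ i → IsLeast (Good i (δ k n)) (leastGood i (δ k n))) (sym (k∸ l 0 eq))
        (leastGood-least k (δ k n) (n ∸ k) good-top)
      leastGood-w (suc N) (suc l) 1≤l eq = leastGood-least (suc l) (w (suc N)) (suc x)
        (subst₂ (λ i x′ → Good (suc l) (dq i x′ + ι x′ * w N) (suc x))
          (k∸ (suc l) (suc N) eq) (cong (λ i → leastGood i (w N)) (k∸ (2 ℕ.+ l) N (shift {suc l} {N} eq)))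
          (good-suc l (w N) x (l≤k (shift {suc l} {N} eq)) (proj₁ (leastGood-w N (2 ℕ.+ l) (s≤s z≤n) (shift {suc l} {N} eq)))))
        where
        x : ℕ
        x = leastGood (2 ℕ.+ l) (w N)

    thresholds-leastGood : LeastGood thresholds
    thresholds-leastGood l N 1≤l eq =
      subst₂ (λ v v′ → IsLeast (Good l v) (leastGood l v′)) (sym (W-thresholds N l eq)) (cong w (sym (∸k l N eq)))
        (leastGood-w N l 1≤l eq)

    -- The bound of the statement in terms of W

    private
      ∏t : (ℕ → ℕ) → ℕ → ℕ → ℚ
      ∏t t l zero    = 1ℚ
      ∏t t l (suc r) = ι (t (suc l)) * ∏t t (suc l) r

      ∏t-∏ : ∀ t l r → ι (∏[ j < r ] t (l ℕ.+ 1 ℕ.+ toℕ j)) ≡ ∏t t l r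
      ∏t-∏ t l zero    = +-identityʳ 1ℚ
      ∏t-∏ t l (suc r) = trans (ι-* (t (l ℕ.+ 1 ℕ.+ 0)) (∏[ j < r ] t (l ℕ.+ 1 ℕ.+ suc (toℕ j))))
        (cong₂ (λ a b → ι (t a) * b) (trans (ℕ.+-identityʳ (l ℕ.+ 1)) (ℕ.+-comm l 1))
          (trans (cong ι (∏.sum-cong-≗ {r} (λ j → cong t (ℕ.+-suc (l ℕ.+ 1) (toℕ j))))) (∏t-∏ t (suc l) r)))

      product-∏t : ∀ t l r → product t l (l ℕ.+ r) ≡ ∏t t l r
      product-∏t t l r = trans (sym (ι≡/1 (∏[ j < l ℕ.+ r ∸ l ] t (l ℕ.+ 1 ℕ.+ toℕ j))))
        (trans (cong (λ m → ι (∏[ j < m ] t (l ℕ.+ 1 ℕ.+ toℕ j))) (ℕ.m+n∸m≡n l r)) (∏t-∏ t l r))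

      -- `W` evaluates the sum in `bound` by Horner's scheme: the term for r = 0 is split off, and t
      -- (suc l) is a common factor of all that remains.
      W-∑ : ∀ t N l → ∑[ r < N ] (∏t t l (toℕ r) * dq (l ℕ.+ toℕ r) (t (l ℕ.+ toℕ r ℕ.+ 1))) + ∏t t l N * δ k n ≡ W t l N
      W-∑ t zero    l = trans (+-identityˡ (1ℚ * δ k n)) (*-identityˡ (δ k n))
      W-∑ t (suc N) l = begin
        1ℚ * dq (l ℕ.+ 0) (t (l ℕ.+ 0 ℕ.+ 1)) +
        ∑[ r < N ] (a * ∏t t (suc l) (toℕ r) * dq (l ℕ.+ suc (toℕ r)) (t (l ℕ.+ suc (toℕ r) ℕ.+ 1))) +
        a * ∏t t (suc l) N * δ k n
          ≡⟨ cong₂ (λ x y → 1ℚ * x + y + a * ∏t t (suc l) N * δ k n)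
               (cong₂ (λ i j → dq i (t j)) (ℕ.+-identityʳ l) (trans (cong (ℕ._+ 1) (ℕ.+-identityʳ l)) (ℕ.+-comm l 1)))
               (trans (sum-cong-≗ {N} (λ r → term (toℕ r))) (sym (*-distribˡ-sum {N} a (λ r → f (toℕ r))))) ⟩
        1ℚ * dq l (t (suc l)) + a * ∑[ r < N ] f (toℕ r) + a * ∏t t (suc l) N * δ k n
          ≡⟨ alg (dq l (t (suc l))) a (∑[ r < N ] f (toℕ r)) (∏t t (suc l) N) (δ k n) (W t (suc l) N) (W-∑ t N (suc l)) ⟩
        dq l (t (suc l)) + a * W t (suc l) N ∎
        where
        open ≡-Reasoning
        a : ℚ
        a = ι (t (suc l))
        f : ℕ → ℚ
        f r = ∏t t (suc l) r * dq (suc l ℕ.+ r) (t (suc l ℕ.+ r ℕ.+ 1))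
        term : ∀ r → a * ∏t t (suc l) r * dq (l ℕ.+ suc r) (t (l ℕ.+ suc r ℕ.+ 1)) ≡ a * f r
        term r = trans (cong (λ i → a * ∏t t (suc l) r * dq i (t (i ℕ.+ 1))) (ℕ.+-suc l r))
          (*-assoc a (∏t t (suc l) r) (dq (suc l ℕ.+ r) (t (suc l ℕ.+ r ℕ.+ 1))))
        alg : ∀ d a s p e v → s + p * e ≡ v → 1ℚ * d + a * s + a * p * e ≡ d + a * v
        alg d a s p e v refl = solve (d ∷ a ∷ s ∷ p ∷ e ∷ []) ℚ-ring

      bound-W : ∀ t l N → InRange t → suc l ℕ.+ N ≡ k → ι (suc l) * bound t (suc l) ≡ W t (suc l) N
      bound-W t l N range eq = begin
        ι L * (inv l * ∑[ r < k ∸ L ] (product t L (L ℕ.+ toℕ r) * d (L ℕ.+ toℕ r) (t (L ℕ.+ toℕ r ℕ.+ 1))) + inv l * product t L k * δ k n)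
          ≡⟨ cong₂ (λ m p → ι L * (inv l * ∑[ r < m ] (product t L (L ℕ.+ toℕ r) * d (L ℕ.+ toℕ r) (t (L ℕ.+ toℕ r ℕ.+ 1))) + inv l * p * δ k n))
               (∸k L N eq) (trans (cong (product t L) (sym eq)) (product-∏t t L N)) ⟩
        ι L * (inv l * ∑[ r < N ] (product t L (L ℕ.+ toℕ r) * d (L ℕ.+ toℕ r) (t (L ℕ.+ toℕ r ℕ.+ 1))) + inv l * ∏t t L N * δ k n)
          ≡⟨ cong (λ x → ι L * (inv l * x + inv l * ∏t t L N * δ k n)) (sum-cong-≗ {N} (λ r → term (toℕ r) (toℕ<n r))) ⟩
        ι L * (inv l * ∑[ r < N ] f (toℕ r) + inv l * ∏t t L N * δ k n)
          ≡⟨ alg (ι L) (inv l) (∑[ r < N ] f (toℕ r)) (∏t t L N) (δ k n) (W t L N) (inv-inverse l) (W-∑ t N L) ⟩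
        W t L N ∎
        where
        open ≡-Reasoning
        L : ℕ
        L = suc l
        f : ℕ → ℚ
        f r = ∏t t L r * dq (L ℕ.+ r) (t (L ℕ.+ r ℕ.+ 1))
        term : ∀ r → r ℕ.< N → product t L (L ℕ.+ r) * d (L ℕ.+ r) (t (L ℕ.+ r ℕ.+ 1)) ≡ f r
        term r r<N = cong₂ _*_ (product-∏t t L r)
          (d≡dq i (t (i ℕ.+ 1)) (ℕ.<⇒≤ i+t<n) (ℕ.≤-trans (s≤s (ℕ.m≤n+m (t (i ℕ.+ 1)) i)) i+t<n))
          where
          i : ℕ
          i = L ℕ.+ r
          i+1≤k : i ℕ.+ 1 ℕ.≤ k
          i+1≤k = subst₂ ℕ._≤_ (ℕ.+-comm 1 i) eq (ℕ.+-monoʳ-< L r<N)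
          -- `d i` is taken at a threshold for i + 1, which is at most n - i - 1 and thus lies in
          -- the range where `d≡dq` applies.
          i+t<n : i ℕ.+ t (i ℕ.+ 1) ℕ.< n
          i+t<n = subst (ℕ._≤ n) (cong (ℕ._+ t (i ℕ.+ 1)) (ℕ.+-comm i 1))
            (≤∸⇒+≤ i+1≤k (proj₂ (range (i ℕ.+ 1) (ℕ.m≤n+m 1 i) i+1≤k)))
        alg : ∀ a v s p e x → v * a ≡ 1ℚ → s + p * e ≡ x → a * (v * s + v * p * e) ≡ x
        alg a v s p e x h refl = lincomb₁ (s + p * e) h (solve (a ∷ v ∷ s ∷ p ∷ e ∷ []) ℚ-ring)

      BelowBound : (ℕ → ℕ) → ℕ → ℕ → Set
      BelowBound t l x = 1 ℕ.≤ x × x ℕ.≤ n ∸ suc l × d (suc l) x ≤ bound t (suc l)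

      d≡dq-suc : ∀ l x → suc l ℕ.≤ k → x ℕ.≤ n ∸ suc l → d (suc l) x ≡ dq (suc l) x
      d≡dq-suc l x l<k x≤ = d≡dq (suc l) x (≤∸⇒+≤ l<k x≤) (ℕ.≤-trans (s≤s (ℕ.m≤n+m x l)) (≤∸⇒+≤ l<k x≤))

      belowBound⇒good : ∀ t l N x → InRange t → suc l ℕ.+ N ≡ k → BelowBound t l x → Good (suc l) (W t (suc l) N) x
      belowBound⇒good t l N x range eq (1≤x , x≤ , le) = 1≤x , x≤ ,
        subst₂ (λ a b → ι (suc l) * a ≤ b) (d≡dq-suc l x (l≤k eq) x≤) (bound-W t l N range eq)
          (*-monoˡ-≤-nonNeg (ι (suc l)) {{ι-nonNeg (suc l)}} le)

      good⇒belowBound : ∀ t l N x → InRange t → suc l ℕ.+ N ≡ k → Good (suc l) (W t (suc l) N) x → BelowBound t l x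
      good⇒belowBound t l N x range eq (1≤x , x≤ , le) = 1≤x , x≤ ,
        *-cancelˡ-≤-pos (ι (suc l)) {{ι-pos (suc l)}}
          (subst₂ (λ a b → ι (suc l) * a ≤ b) (sym (d≡dq-suc l x (l≤k eq) x≤)) (sym (bound-W t l N range eq)) le)

    thresholds⇒inRange : ∀ {t} → IsThresholds t → InRange t
    thresholds⇒inRange th (suc l) _ l<k = proj₁ (proj₁ (th (suc l) l<k)) , proj₁ (proj₂ (proj₁ (th (suc l) l<k)))

    thresholds⇒leastGood : ∀ {t} → IsThresholds t → LeastGood t
    thresholds⇒leastGood {t} th (suc l) N _ eq =
      belowBound⇒good t l N (t (suc l)) (thresholds⇒inRange th) eq (proj₁ (th (suc l) (l≤k eq))) ,
      λ y good → proj₂ (th (suc l) (l≤k eq)) y (good⇒belowBound t l N y (thresholds⇒inRange th) eq good)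

    leastGood⇒inRange : ∀ {t} → LeastGood t → InRange t
    leastGood⇒inRange least l 1≤l l≤k = proj₁ good , proj₁ (proj₂ good)
      where good = proj₁ (least l (k ∸ l) 1≤l (ℕ.m+[n∸m]≡n l≤k))

    leastGood⇒thresholds : ∀ {t} → LeastGood t → IsThresholds t
    leastGood⇒thresholds {t} least (suc l) l<k =
      good⇒belowBound t l N (t (suc l)) range eq (proj₁ (least (suc l) N (s≤s z≤n) eq)) ,
      λ y below → proj₂ (least (suc l) N (s≤s z≤n) eq) y (belowBound⇒good t l N y range eq below)
      where
      N : ℕ
      N = k ∸ suc l
      eq : suc l ℕ.+ N ≡ k
      eq = ℕ.m+[n∸m]≡n l<k
      range : InRange t
      range = leastGood⇒inRange least

    -- Admissibility and optimality

    module _ (t : ℕ → ℕ) (least : LeastGood t) where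

      private
        s : ℕ → ℕ
        s l = t l ℕ.+ l ∸ 1

        range : InRange t
        range = leastGood⇒inRange least

        s≡t : ∀ l → s (suc l) ≡ l ℕ.+ t (suc l)
        s≡t l = trans (cong (_∸ 1) (ℕ.+-suc (t (suc l)) l)) (ℕ.+-comm (t (suc l)) l)

        s-suc : ∀ l → suc (suc l) ℕ.≤ k → s (suc l) ℕ.≤ s (suc (suc l))
        s-suc l l<k = subst₂ ℕ._≤_ (sym (s≡t l)) (trans (ℕ.+-suc l (t (2 ℕ.+ l))) (sym (s≡t (suc l))))
          (ℕ.+-monoʳ-≤ l (proj₂ (least (suc l) (suc N) (s≤s z≤n) eq′) (suc (t (2 ℕ.+ l)))
            (good-suc l (W t (2 ℕ.+ l) N) (t (2 ℕ.+ l)) l<k (proj₁ (least (2 ℕ.+ l) N (s≤s z≤n) eq)))))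
          where
          N : ℕ
          N = k ∸ suc (suc l)
          eq : suc (suc l) ℕ.+ N ≡ k
          eq = ℕ.m+[n∸m]≡n l<k
          eq′ : suc l ℕ.+ suc N ≡ k
          eq′ = trans (ℕ.+-suc (suc l) N) eq

        s-mono : ∀ l e → suc l ℕ.+ e ℕ.≤ k → s (suc l) ℕ.≤ s (suc l ℕ.+ e)
        s-mono l zero    _  = ℕ.≤-reflexive (cong s (sym (ℕ.+-identityʳ (suc l))))
        s-mono l (suc e) le = ℕ.≤-trans (s-mono l e (ℕ.<⇒≤ le′))
          (subst (λ m → s (suc l ℕ.+ e) ℕ.≤ s m) (sym (ℕ.+-suc (suc l) e)) (s-suc (l ℕ.+ e) le′))
          where
          le′ : suc (suc l ℕ.+ e) ℕ.≤ k
          le′ = subst (ℕ._≤ k) (ℕ.+-suc (suc l) e) le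

      admissible : IsAdmissible s
      admissible = bounds , monotone
        where
        bounds : ∀ l → 1 ℕ.≤ l → l ℕ.≤ k → l ℕ.≤ s l × s l ℕ.< n
        bounds (suc l) 1≤l l<k =
          subst₂ ℕ._≤_ (ℕ.+-comm l 1) (sym (s≡t l)) (ℕ.+-monoʳ-≤ l (proj₁ (range (suc l) 1≤l l<k))) ,
          subst (ℕ._< n) (sym (s≡t l)) (≤∸⇒+≤ l<k (proj₂ (range (suc l) 1≤l l<k)))
        monotone : ∀ l m → 1 ℕ.≤ l → l ℕ.≤ m → m ℕ.≤ k → s l ℕ.≤ s m
        monotone (suc l) m _ l≤m m≤k = subst (λ m → s (suc l) ℕ.≤ s m) (ℕ.m+[n∸m]≡n l≤m)
          (s-mono l (m ∸ suc l) (subst (ℕ._≤ k) (sym (ℕ.m+[n∸m]≡n l≤m)) m≤k))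

      optimal : IsOptimal s
      optimal = admissible , λ s′ adm → subst₂ _≤_
        (sym (Pr≡-W s′ (t′ s′) adm (λ l l<k → sym (ℕ.m+[n∸m]≡n (ℕ.<⇒≤ (proj₁ (proj₁ adm (suc l) (s≤s z≤n) l<k)))))))
        (sym (Pr≡-W s t admissible (λ l _ → s≡t l)))
        (neg-antimono-≤ (W-min t (t′ s′) least (range′ s′ adm) k 0 refl))
        where
        -- The inverse of s l = t l + l - 1. Admissibility of s′ gives l ≤ s′ l < n, which is
        -- exactly the range required of t′.
        t′ : (ℕ → ℕ) → ℕ → ℕ
        t′ s′ l = suc (s′ l) ∸ l
        range′ : ∀ s′ → IsAdmissible s′ → InRange (t′ s′)
        range′ s′ adm l 1≤l l≤k =
          ℕ.m<n⇒0<n∸m (s≤s (proj₁ (proj₁ adm l 1≤l l≤k))) , ℕ.∸-monoˡ-≤ l (proj₂ (proj₁ adm l 1≤l l≤k))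

open import Data.Nat.Base using (ℕ; suc; s≤s; _+_; _∸_; _≤_; _<_)
open import Data.Product.Base using (∃-syntax; _×_; _,_)

theorem2 : (n k : ℕ) → 1 ≤ k → (k<n : k < n) →
    (∃[ t ] Secretary.IsThresholds n k k<n t) ×
    (∀ t → Secretary.IsThresholds n k k<n t →
    Secretary.IsOptimal n k k<n (λ l → t l + l ∸ 1))
theorem2 (suc n′) k 1≤k (s≤s k≤n′) =
  (thresholds , leastGood⇒thresholds thresholds-leastGood) , λ t th → optimal t (thresholds⇒leastGood th)
  where open Proof.Thresholds n′ k 1≤k k≤n′
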